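{- Let $n\ge 1$ and let $L=\sum_{i=1}^k c_i(1+t)^{n_i}H_i\in\mathbb{G}[t]$, where each $H_i$ is a graph with vertex set $[n]$, be written in Tutte standard form. Then $L$ is a modular relation for $XB$ if and only if for every set partition $\pi$ of $[n]$ we have $$B(L;\pi):=\sum_{i=1}^k c_i(1+t)^{n_i+e_{H_i}(\pi)}=0 ,$$ where $e_{H_i}(\pi)$ is the number of edges of $H_i$ (counted with multiplicity) with both endpoints in the same block of $\pi$.
   Context: Write $[n]=\{1,\dots,n\}$. A graph is a finite vertex set $V(G)$ together with a finite multiset $E(G)$ of unordered pairs of not necessarily distinct vertices (loops and multi-edges are allowed). $\mathbb{G}$ is the $\mathbb{C}$-vector space freely generated by all (labelled) graphs whose vertex set is $[n]$ for some $n\ge 1$; $\mathbb{G}[t]$ consists of formal linear combinations of such graphs with coefficients in $\mathbb{C}[t]$. Tutte standard form: $L\in\mathbb{G}[t]$ is written in Tutte standard form when it is written as $L=\sum_{i=1}^k c_i(1+t)^{n_i}H_i$ with $c_i\in\mathbb{C}$, $n_i$ a nonnegative integer and $H_i$ a graph for all $i$, such that $(n_{i},H_{i})\ne(n_{j},H_{j})$ for $i\neq j$ (the same graph may occur several times). Tutte symmetric function: for a graph $G$, $XB_G(t;x_1,x_2,\dots)=\sum_{\kappa}(1+t)^{e(\kappa)}\prod_{v\in V(G)}x_{\kappa(v)}\in\Lambda[t]$, where the sum is over all maps $\kappa:V(G)\to\{1,2,3,\dots\}$, $e(\kappa)$ is the number of edges of $G$ (with multiplicity; every loop is counted) whose endpoints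 receive the same value under $\kappa$, and $\Lambda[t]$ is the ring of polynomials in $t$ with coefficients in the algebra $\Lambda$ of symmetric functions over $\mathbb{C}$ in $x_1,x_2,\dots$. Extend $\mathbb{C}[t]$-linearly to $XB:\mathbb{G}[t]\to\Lambda[t]$, with kernel $Ker(XB)$. Extension: for a graph $G$ and a multiset $E$ of edges with endpoints in $V(G)$, $G\uplus E$ is the graph with vertex set $V(G)$ and edge multiset $E(G)\uplus E$ (multiplicities are added). For $L=\sum_{i} c_i(t)H_i$ with all $H_i$ graphs on $[n]$ and a graph $G$ on $[N]$, $N\ge n$, set $Ext(L;G)=\sum_i c_i(t)\,(G\uplus E(H_i))$. Modular relation: a linear combination $L\in\mathbb{G}[t]$ of graphs with vertex set $[n]$ is a modular relation for $XB$ if $Ext(L;G)\in Ker(XB)$ for every $N\ge n$ and every graph $G$ with vertex set $[N]$. -}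

module Defs where

open import Algebra.Bundles using (CommutativeRing; CommutativeMonoid)
import Algebra.Properties.Ring as RingProperties
import Algebra.Solver.Ring.NaturalCoefficients.Default as SemiringSolver
open import Algebra.Structures using (IsCommutativeMonoid)
open import Algebra.Structures.Biased using (isCommutativeMonoidˡ)
open import Data.Fin.Base using (Fin; inject≤)
import Data.Fin.Properties as Fin
open import Data.Fin.Subset using (Subset; Nonempty; Empty; _∩_) renaming (_∈_ to _∈ˢ_)
open import Data.Fin.Subset.Properties using () renaming (_∈?_ to _∈ˢ?_)
open import Data.List.Base
  using (List; []; _∷_; [_]; _++_; map; foldr; length; filter; tabulate; deduplicate; cartesianProductWith)
import Data.List.Properties as List
open import Data.List.Membership.Propositional using (_∈_)
open import Data.List.Membership.Propositional.Properties
  using (∈-∃++; ∈-map⁺; ∈-map⁻; ∈-deduplicate⁺; ∈-deduplicate⁻)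
open import Data.List.Membership.Propositional.Properties.WithK using (unique∧set⇒bag)
import Data.List.Membership.DecPropositional as DecMembership
open import Data.List.Relation.Binary.BagAndSetEquality using (∼bag⇒↭)
open import Data.List.Relation.Binary.Permutation.Propositional
  using (_↭_; ↭-refl; ↭-reflexive; ↭-sym; ↭-trans; ↭⇒↭ₛ′; refl; prep; swap; trans)
open import Data.List.Relation.Binary.Permutation.Propositional.Properties
  using (∈-resp-↭; ↭-length; drop-∷; filter-↭)
import Data.List.Relation.Binary.Permutation.Propositional.Properties as Perm
import Data.List.Relation.Binary.Permutation.Setoid as SetoidPerm
import Data.List.Relation.Binary.Permutation.Setoid.Properties as SetoidPermProperties
open import Data.List.Relation.Unary.All as All using (All)
open import Data.List.Relation.Unary.AllPairs using (AllPairs)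
open import Data.List.Relation.Unary.Any using (Any; here; any?)
import Data.List.Relation.Unary.Unique.DecPropositional.Properties as DecUnique
import Data.List.Relation.Unary.Unique.Propositional.Properties as Unique
open import Data.Nat.Base as ℕ using (ℕ; zero; suc; NonZero)
import Data.Nat.Properties as ℕ
open import Data.Product.Base as Product using (∃-syntax; _×_; _,_; uncurry)
open import Data.Rational.Base as ℚ using (ℚ; 0ℚ; 1ℚ; ½; ∣_∣)
import Data.Rational.Properties as ℚ
import Data.Rational.Solver as ℚ
open import Data.Sum.Base using (_⊎_; inj₁; inj₂)
open import Data.Vec.Base as Vec using (Vec; []; _∷_; lookup; toList)
import Data.Vec.Properties as Vec
open import Function.Base using (_∘_)
open import Function.Bundles using (_↔_; Inverse; mk⇔)
open import Function.Construct.Identity using (↔-id)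
open import Level using (Level; 0ℓ; _⊔_)
open import Relation.Binary.Bundles using (Setoid)
open import Relation.Binary.Definitions using (Decidable)
open import Relation.Binary.PropositionalEquality as ≡ using (_≡_; _≢_)
open import Relation.Binary.Structures using (IsEquivalence)
open import Relation.Nullary.Decidable using (yes; no; _×-dec_; map′)
open import Relation.Nullary.Negation using (¬_)

-- ℝ is the ring of Cauchy sequences of rationals modulo null sequences, and
-- ℂ is ℝ[i].

private
  ∣+∣< : ∀ {ε p q} → ∣ p ∣ ℚ.< ½ ℚ.* ε → ∣ q ∣ ℚ.< ½ ℚ.* ε → ∣ p ℚ.+ q ∣ ℚ.< ε
  ∣+∣< {ε} {p} {q} p< q< = ℚ.≤-<-trans (ℚ.∣p+q∣≤∣p∣+∣q∣ p q)
    (≡.subst (_ ℚ.<_) half+half (ℚ.+-mono-< p< q<))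
    where
    half+half : ½ ℚ.* ε ℚ.+ ½ ℚ.* ε ≡ ε
    half+half = ≡.trans (≡.sym (ℚ.*-distribʳ-+ ε ½ ½)) (ℚ.*-identityˡ ε)

  *-pos : ∀ {p q} → 0ℚ ℚ.< p → 0ℚ ℚ.< q → 0ℚ ℚ.< p ℚ.* q
  *-pos {p} {q} 0<p 0<q = ℚ.positive⁻¹ (p ℚ.* q) {{ℚ.pos*pos⇒pos p {{ℚ.positive 0<p}} q {{ℚ.positive 0<q}}}}

  half-pos : ∀ {ε} → 0ℚ ℚ.< ε → 0ℚ ℚ.< ½ ℚ.* ε
  half-pos = *-pos (ℚ.positive⁻¹ ½)

  quotient : ∀ {K ε} → 0ℚ ℚ.< K → 0ℚ ℚ.< ε → ∃[ δ ] 0ℚ ℚ.< δ × K ℚ.* δ ≡ ε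
  quotient {K} {ε} 0<K 0<ε = K⁻¹ ℚ.* ε , *-pos (ℚ.positive⁻¹ K⁻¹ {{ℚ.1/pos⇒pos K {{posK}}}}) 0<ε ,
    ≡.trans (≡.sym (ℚ.*-assoc K K⁻¹ ε))
      (≡.trans (≡.cong (ℚ._* ε) (ℚ.*-inverseʳ K {{nzK}})) (ℚ.*-identityˡ ε))
    where
    posK = ℚ.positive 0<K
    nzK = ℚ.pos⇒nonZero K {{posK}}
    K⁻¹ = ℚ.1/_ K {{nzK}}

  ∣*∣< : ∀ {K δ} p q → 0ℚ ℚ.< K → ∣ p ∣ ℚ.< K → ∣ q ∣ ℚ.< δ → ∣ p ℚ.* q ∣ ℚ.< K ℚ.* δ
  ∣*∣< {K} {δ} p q 0<K p< q< = ≡.subst (ℚ._< K ℚ.* δ) (≡.sym (ℚ.∣p*q∣≡∣p∣*∣q∣ p q))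
    (ℚ.≤-<-trans (ℚ.*-monoʳ-≤-nonNeg ∣ q ∣ {{ℚ.∣-∣-nonNeg q}} (ℚ.<⇒≤ p<))
                 (ℚ.*-monoʳ-<-pos K {{ℚ.positive 0<K}} q<))

Cauchy : (ℕ → ℚ) → Set
Cauchy x = ∀ ε → 0ℚ ℚ.< ε → ∃[ N ] ∀ m n → N ℕ.≤ m → N ℕ.≤ n → ∣ x m ℚ.- x n ∣ ℚ.< ε

Null : (ℕ → ℚ) → Set
Null x = ∀ ε → 0ℚ ℚ.< ε → ∃[ N ] ∀ n → N ℕ.≤ n → ∣ x n ∣ ℚ.< ε

record ℝ : Set where
  constructor mkℝ
  field
    seq    : ℕ → ℚ
    cauchy : Cauchy seq

open ℝ

infix 4 _≈ʳ_

record _≈ʳ_ (x y : ℝ) : Set where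
  constructor mk≈
  field
    null : Null (λ n → seq x n ℚ.- seq y n)

open _≈ʳ_

private
  Bounded : (ℕ → ℚ) → Set
  Bounded x = ∃[ K ] 0ℚ ℚ.< K × ∃[ N ] ∀ n → N ℕ.≤ n → ∣ x n ∣ ℚ.< K

  cauchy⇒bounded : ∀ x → Cauchy x → Bounded x
  cauchy⇒bounded x cx with cx 1ℚ (ℚ.positive⁻¹ 1ℚ)
  ... | N , close = ∣ x N ∣ ℚ.+ 1ℚ
      , ℚ.≤-<-trans (ℚ.0≤∣p∣ (x N)) (≡.subst (ℚ._< ∣ x N ∣ ℚ.+ 1ℚ) (ℚ.+-identityʳ ∣ x N ∣) (ℚ.+-monoʳ-< ∣ x N ∣ (ℚ.positive⁻¹ 1ℚ)))
      , N , λ n N≤n → ≡.subst (λ q → ∣ q ∣ ℚ.< ∣ x N ∣ ℚ.+ 1ℚ) (cancel (x N) (x n))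
          (ℚ.≤-<-trans (ℚ.∣p+q∣≤∣p∣+∣q∣ (x N) (x n ℚ.- x N)) (ℚ.+-monoʳ-< ∣ x N ∣ (close n N N≤n ℕ.≤-refl)))
    where
    open ℚ.+-*-Solver
    cancel : ∀ a b → a ℚ.+ (b ℚ.- a) ≡ b
    cancel = solve 2 (λ a b → a :+ (b :- a) := b) ≡.refl

  null-cong : ∀ {x y} → (∀ n → x n ≡ y n) → Null x → Null y
  null-cong x≗y nx ε 0<ε with nx ε 0<ε
  ... | N , f = N , λ n N≤n → ≡.subst (λ q → ∣ q ∣ ℚ.< ε) (x≗y n) (f n N≤n)

  null-0 : ∀ {x} → (∀ n → x n ≡ 0ℚ) → Null x
  null-0 x≗0 ε 0<ε = 0 , λ n _ → ≡.subst (λ q → ∣ q ∣ ℚ.< ε) (≡.sym (x≗0 n)) 0<ε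

  null-+ : ∀ {x y} → Null x → Null y → Null (λ n → x n ℚ.+ y n)
  null-+ nx ny ε 0<ε with nx _ (half-pos 0<ε) | ny _ (half-pos 0<ε)
  ... | M , f | N , g = M ℕ.⊔ N , λ n le →
    ∣+∣< (f n (ℕ.m⊔n≤o⇒m≤o M N le)) (g n (ℕ.m⊔n≤o⇒n≤o M N le))

  null-neg : ∀ {x} → Null x → Null (λ n → ℚ.- x n)
  null-neg {x} nx ε 0<ε with nx ε 0<ε
  ... | N , f = N , λ n le → ≡.subst (ℚ._< ε) (≡.sym (ℚ.∣-p∣≡∣p∣ (x n))) (f n le)

  null-* : ∀ {x y} → Bounded x → Null y → Null (λ n → x n ℚ.* y n)
  null-* {x} {y} (K , 0<K , M , bx) ny ε 0<ε with quotient 0<K 0<ε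
  ... | δ , 0<δ , ≡.refl with ny δ 0<δ
  ... | N , g = M ℕ.⊔ N , λ n le →
    ∣*∣< (x n) (y n) 0<K (bx n (ℕ.m⊔n≤o⇒m≤o M N le)) (g n (ℕ.m⊔n≤o⇒n≤o M N le))

  ≗⇒≈ : ∀ {x y} → (∀ n → seq x n ≡ seq y n) → x ≈ʳ y
  ≗⇒≈ {x} {y} x≗y = mk≈ (null-0 λ n → ≡.trans (≡.cong (ℚ._- seq y n) (x≗y n)) (ℚ.+-inverseʳ (seq y n)))

constant : ℚ → ℝ
constant q = mkℝ (λ _ → q) λ ε 0<ε → 0 , λ _ _ _ _ → ≡.subst (λ p → ∣ p ∣ ℚ.< ε) (≡.sym (ℚ.+-inverseʳ q)) 0<ε

infixl 6 _+ʳ_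
infixl 7 _*ʳ_

_+ʳ_ : ℝ → ℝ → ℝ
mkℝ x cx +ʳ mkℝ y cy = mkℝ (λ n → x n ℚ.+ y n) λ ε 0<ε →
  let M , f = cx _ (half-pos 0<ε)
      N , g = cy _ (half-pos 0<ε)
  in M ℕ.⊔ N , λ m n le le′ →
    ≡.subst (λ q → ∣ q ∣ ℚ.< ε) (rearrange (x m) (x n) (y m) (y n))
      (∣+∣< (f m n (ℕ.m⊔n≤o⇒m≤o M N le) (ℕ.m⊔n≤o⇒m≤o M N le′))
            (g m n (ℕ.m⊔n≤o⇒n≤o M N le) (ℕ.m⊔n≤o⇒n≤o M N le′)))
  where
  open ℚ.+-*-Solver
  rearrange : ∀ a b c d → (a ℚ.- b) ℚ.+ (c ℚ.- d) ≡ (a ℚ.+ c) ℚ.- (b ℚ.+ d)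
  rearrange = solve 4 (λ a b c d → (a :- b) :+ (c :- d) := (a :+ c) :- (b :+ d)) ≡.refl

-ʳ_ : ℝ → ℝ
-ʳ mkℝ x cx = mkℝ (λ n → ℚ.- x n) λ ε 0<ε →
  let N , f = cx ε 0<ε
  in N , λ m n le le′ → ≡.subst (ℚ._< ε)
    (≡.trans (≡.sym (ℚ.∣-p∣≡∣p∣ (x m ℚ.- x n))) (≡.cong ∣_∣ (ℚ.neg-distrib-+ (x m) (ℚ.- x n))))
    (f m n le le′)

_*ʳ_ : ℝ → ℝ → ℝ
mkℝ x cx *ʳ mkℝ y cy = mkℝ (λ n → x n ℚ.* y n) λ ε 0<ε →
  let K , 0<K , M , bx = cauchy⇒bounded x cx
      L , 0<L , N , by = cauchy⇒bounded y cy
      δ , 0<δ , Kδ = quotient 0<K (half-pos 0<ε)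
      η , 0<η , Lη = quotient 0<L (half-pos 0<ε)
      P , f = cx η 0<η
      Q , g = cy δ 0<δ
  in (M ℕ.⊔ N) ℕ.⊔ (P ℕ.⊔ Q) , λ m n le le′ →
    let leM = ℕ.m⊔n≤o⇒m≤o M N (ℕ.m⊔n≤o⇒m≤o (M ℕ.⊔ N) (P ℕ.⊔ Q) le)
        leN = ℕ.m⊔n≤o⇒n≤o M N (ℕ.m⊔n≤o⇒m≤o (M ℕ.⊔ N) (P ℕ.⊔ Q) le′)
        leP  = ℕ.m⊔n≤o⇒m≤o P Q (ℕ.m⊔n≤o⇒n≤o (M ℕ.⊔ N) (P ℕ.⊔ Q) le)
        leP′ = ℕ.m⊔n≤o⇒m≤o P Q (ℕ.m⊔n≤o⇒n≤o (M ℕ.⊔ N) (P ℕ.⊔ Q) le′)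
        leQ  = ℕ.m⊔n≤o⇒n≤o P Q (ℕ.m⊔n≤o⇒n≤o (M ℕ.⊔ N) (P ℕ.⊔ Q) le)
        leQ′ = ℕ.m⊔n≤o⇒n≤o P Q (ℕ.m⊔n≤o⇒n≤o (M ℕ.⊔ N) (P ℕ.⊔ Q) le′)
    in ≡.subst (λ q → ∣ q ∣ ℚ.< ε) (rearrange (x m) (x n) (y m) (y n))
      (∣+∣< (≡.subst (∣ x m ℚ.* (y m ℚ.- y n) ∣ ℚ.<_) Kδ (∣*∣< (x m) (y m ℚ.- y n) 0<K (bx m leM) (g m n leQ leQ′)))
            (≡.subst (∣ y n ℚ.* (x m ℚ.- x n) ∣ ℚ.<_) Lη (∣*∣< (y n) (x m ℚ.- x n) 0<L (by n leN) (f m n leP leP′))))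
  where
  open ℚ.+-*-Solver
  rearrange : ∀ a b c d → a ℚ.* (c ℚ.- d) ℚ.+ d ℚ.* (a ℚ.- b) ≡ a ℚ.* c ℚ.- b ℚ.* d
  rearrange = solve 4 (λ a b c d → a :* (c :- d) :+ d :* (a :- b) := a :* c :- b :* d) ≡.refl

private
  module _ where
    open ℚ.+-*-Solver

    ≈ʳ-isEquivalence : IsEquivalence _≈ʳ_
    ≈ʳ-isEquivalence = record
      { refl  = ≗⇒≈ λ _ → ≡.refl
      ; sym   = λ {x} {y} p → mk≈ (null-cong
          (λ n → solve 2 (λ a b → :- (a :- b) := b :- a) ≡.refl (seq x n) (seq y n)) (null-neg (null p)))
      ; trans = λ {x} {y} {z} p q → mk≈ (null-cong
          (λ n → solve 3 (λ a b c → (a :- b) :+ (b :- c) := a :- c) ≡.refl (seq x n) (seq y n) (seq z n))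
          (null-+ (null p) (null q)))
      }

    +ʳ-cong : ∀ {x x′ y y′} → x ≈ʳ x′ → y ≈ʳ y′ → x +ʳ y ≈ʳ x′ +ʳ y′
    +ʳ-cong {x} {x′} {y} {y′} p q = mk≈ (null-cong
      (λ n → solve 4 (λ a b c d → (a :- b) :+ (c :- d) := (a :+ c) :- (b :+ d)) ≡.refl
        (seq x n) (seq x′ n) (seq y n) (seq y′ n))
      (null-+ (null p) (null q)))

    -ʳ-cong : ∀ {x y} → x ≈ʳ y → -ʳ x ≈ʳ -ʳ y
    -ʳ-cong {x} {y} p = mk≈ (null-cong
      (λ n → solve 2 (λ a b → :- (a :- b) := (:- a) :- (:- b)) ≡.refl (seq x n) (seq y n))
      (null-neg (null p)))

    *ʳ-cong : ∀ {x x′ y y′} → x ≈ʳ x′ → y ≈ʳ y′ → x *ʳ y ≈ʳ x′ *ʳ y′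
    *ʳ-cong {x} {x′} {y} {y′} p q = mk≈ (null-cong
      (λ n → solve 4 (λ a b c d → a :* (c :- d) :+ d :* (a :- b) := a :* c :- b :* d) ≡.refl
        (seq x n) (seq x′ n) (seq y n) (seq y′ n))
      (null-+ (null-* (cauchy⇒bounded (seq x) (cauchy x)) (null q))
              (null-* (cauchy⇒bounded (seq y′) (cauchy y′)) (null p))))

ℝ-commutativeRing : CommutativeRing 0ℓ 0ℓ
ℝ-commutativeRing = record
  { Carrier = ℝ ; _≈_ = _≈ʳ_ ; _+_ = _+ʳ_ ; _*_ = _*ʳ_ ; -_ = -ʳ_ ; 0# = constant 0ℚ ; 1# = constant 1ℚ
  ; isCommutativeRing = record
    { isRing = record
      { +-isAbelianGroup = record
        { isGroup = record
          { isMonoid = record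
            { isSemigroup = record
              { isMagma = record { isEquivalence = ≈ʳ-isEquivalence ; ∙-cong = +ʳ-cong }
              ; assoc = λ x y z → ≗⇒≈ λ n → ℚ.+-assoc (seq x n) (seq y n) (seq z n)
              }
            ; identity = (λ x → ≗⇒≈ λ n → ℚ.+-identityˡ (seq x n)) , (λ x → ≗⇒≈ λ n → ℚ.+-identityʳ (seq x n))
            }
          ; inverse = (λ x → ≗⇒≈ λ n → ℚ.+-inverseˡ (seq x n)) , (λ x → ≗⇒≈ λ n → ℚ.+-inverseʳ (seq x n))
          ; ⁻¹-cong = -ʳ-cong
          }
        ; comm = λ x y → ≗⇒≈ λ n → ℚ.+-comm (seq x n) (seq y n)
        }
      ; *-cong = *ʳ-cong
      ; *-assoc = λ x y z → ≗⇒≈ λ n → ℚ.*-assoc (seq x n) (seq y n) (seq z n)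
      ; *-identity = (λ x → ≗⇒≈ λ n → ℚ.*-identityˡ (seq x n)) , (λ x → ≗⇒≈ λ n → ℚ.*-identityʳ (seq x n))
      ; distrib = (λ x y z → ≗⇒≈ λ n → ℚ.*-distribˡ-+ (seq x n) (seq y n) (seq z n))
                , (λ x y z → ≗⇒≈ λ n → ℚ.*-distribʳ-+ (seq x n) (seq y n) (seq z n))
      }
    ; *-comm = λ x y → ≗⇒≈ λ n → ℚ.*-comm (seq x n) (seq y n)
    }
  }

module Adjoin-i {c ℓ} (R : CommutativeRing c ℓ) where

  open CommutativeRing R using (Carrier; _≈_; _+_; _*_; -_; 0#; 1#)
  private
    module R = CommutativeRing R
    open SemiringSolver R.commutativeSemiring using (solve; _:+_; _:*_; _:=_)

  record R[i] : Set c where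
    constructor _+i_
    field
      re im : Carrier

  open R[i]

  record _≈ᶜ_ (z w : R[i]) : Set ℓ where
    constructor _,_
    field
      re≈ : re z ≈ re w
      im≈ : im z ≈ im w

  private
    m : Carrier
    m = - 1#

    -≈m* : ∀ x → - x ≈ m * x
    -≈m* x = R.sym (RingProperties.-1*x≈-x R.ring x)

    sub≈ : ∀ {x x′ y y′} → x ≈ x′ → y ≈ y′ → x + - y ≈ x′ + m * y′
    sub≈ {y = y} p q = R.+-cong p (R.trans (-≈m* y) (R.*-congˡ q))

    one-left : ∀ a b → 1# * a + - (0# * b) ≈ a
    one-left a b = R.trans
      (R.+-cong (R.*-identityˡ a) (R.trans (R.-‿cong (R.zeroˡ b)) (R.trans (R.sym (R.+-identityʳ _)) (R.-‿inverseˡ 0#))))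
      (R.+-identityʳ a)

  commutativeRing : CommutativeRing c ℓ
  commutativeRing = record
    { Carrier = R[i]
    ; _≈_ = _≈ᶜ_
    ; _+_ = λ { (a +i b) (c +i d) → (a + c) +i (b + d) }
    ; _*_ = λ { (a +i b) (c +i d) → (a * c + - (b * d)) +i (a * d + b * c) }
    ; -_ = λ { (a +i b) → (- a) +i (- b) }
    ; 0# = 0# +i 0#
    ; 1# = 1# +i 0#
    ; isCommutativeRing = record
      { isRing = record
        { +-isAbelianGroup = record
          { isGroup = record
            { isMonoid = record
              { isSemigroup = record
                { isMagma = record
                  { isEquivalence = record
                    { refl = R.refl , R.refl
                    ; sym = λ { (p , q) → R.sym p , R.sym q }
                    ; trans = λ { (p , q) (p′ , q′) → R.trans p p′ , R.trans q q′ }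
                    }
                  ; ∙-cong = λ { (p , q) (p′ , q′) → R.+-cong p p′ , R.+-cong q q′ }
                  }
                ; assoc = λ _ _ _ → R.+-assoc _ _ _ , R.+-assoc _ _ _
                }
              ; identity = (λ _ → R.+-identityˡ _ , R.+-identityˡ _) , (λ _ → R.+-identityʳ _ , R.+-identityʳ _)
              }
            ; inverse = (λ _ → R.-‿inverseˡ _ , R.-‿inverseˡ _) , (λ _ → R.-‿inverseʳ _ , R.-‿inverseʳ _)
            ; ⁻¹-cong = λ { (p , q) → R.-‿cong p , R.-‿cong q }
            }
          ; comm = λ _ _ → R.+-comm _ _ , R.+-comm _ _
          }
        ; *-cong = λ { (p , q) (p′ , q′) →
              R.+-cong (R.*-cong p p′) (R.-‿cong (R.*-cong q q′))
            , R.+-cong (R.*-cong p q′) (R.*-cong q p′) }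
        ; *-assoc = λ { (a +i b) (c +i d) (e +i f) →
              R.trans (sub≈ (R.*-congʳ (sub≈ R.refl R.refl)) R.refl)
                (R.trans (solve 7 (λ m a b c d e f →
                    (a :* c :+ m :* (b :* d)) :* e :+ m :* ((a :* d :+ b :* c) :* f)
                    := a :* (c :* e :+ m :* (d :* f)) :+ m :* (b :* (c :* f :+ d :* e))) R.refl m a b c d e f)
                  (R.sym (sub≈ (R.*-congˡ (sub≈ R.refl R.refl)) R.refl)))
            , R.trans (R.+-congʳ (R.*-congʳ (sub≈ R.refl R.refl)))
                (R.trans (solve 7 (λ m a b c d e f →
                    (a :* c :+ m :* (b :* d)) :* f :+ (a :* d :+ b :* c) :* e
                    := a :* (c :* f :+ d :* e) :+ b :* (c :* e :+ m :* (d :* f))) R.refl m a b c d e f)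
                  (R.sym (R.+-congˡ (R.*-congˡ (sub≈ R.refl R.refl))))) }
        ; *-identity =
            (λ { (a +i b) → one-left a b , R.trans (R.+-comm _ _) (R.trans (R.+-congʳ (R.zeroˡ a)) (R.trans (R.+-identityˡ _) (R.*-identityˡ b))) })
          , (λ { (a +i b) →
                R.trans (R.+-cong (R.*-comm a 1#) (R.-‿cong (R.*-comm b 0#))) (one-left a b)
              , R.trans (R.+-congʳ (R.zeroʳ a)) (R.trans (R.+-identityˡ _) (R.*-identityʳ b)) })
        ; distrib =
            (λ { (a +i b) (c +i d) (e +i f) →
                R.trans (sub≈ R.refl R.refl)
                  (R.trans (solve 7 (λ m a b c d e f → a :* (c :+ e) :+ m :* (b :* (d :+ f))
                      := (a :* c :+ m :* (b :* d)) :+ (a :* e :+ m :* (b :* f))) R.refl m a b c d e f)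
                    (R.sym (R.+-cong (sub≈ R.refl R.refl) (sub≈ R.refl R.refl))))
              , solve 6 (λ a b c d e f → a :* (d :+ f) :+ b :* (c :+ e)
                  := (a :* d :+ b :* c) :+ (a :* f :+ b :* e)) R.refl a b c d e f })
          , (λ { (a +i b) (c +i d) (e +i f) →
                R.trans (sub≈ R.refl R.refl)
                  (R.trans (solve 7 (λ m a b c d e f → (c :+ e) :* a :+ m :* ((d :+ f) :* b)
                      := (c :* a :+ m :* (d :* b)) :+ (e :* a :+ m :* (f :* b))) R.refl m a b c d e f)
                    (R.sym (R.+-cong (sub≈ R.refl R.refl) (sub≈ R.refl R.refl))))
              , solve 6 (λ a b c d e f → (c :+ e) :* b :+ (d :+ f) :* a
                  := (c :* b :+ d :* a) :+ (e :* b :+ f :* a)) R.refl a b c d e f })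
        }
      ; *-comm = λ { (a +i b) (c +i d) →
            R.+-cong (R.*-comm a c) (R.-‿cong (R.*-comm b d))
          , R.trans (R.+-comm _ _) (R.+-cong (R.*-comm b c) (R.*-comm a d)) }
      }
    }

ℂ-commutativeRing : CommutativeRing 0ℓ 0ℓ
ℂ-commutativeRing = Adjoin-i.commutativeRing ℝ-commutativeRing

-- Fin n stands for [n]. The list of edges of a graph is read as a multiset of
-- unordered pairs; (v , v) is a loop.

Edge : ℕ → Set
Edge n = Fin n × Fin n

infix 4 _≈ᵉ_ _≈ᵍ_

_≈ᵉ_ : ∀ {n} → Edge n → Edge n → Set
e ≈ᵉ f = e ≡ f ⊎ e ≡ Product.swap f

edgeSetoid : ℕ → Setoid 0ℓ 0ℓ
edgeSetoid n = record
  { Carrier = Edge n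
  ; _≈_ = _≈ᵉ_
  ; isEquivalence = record
    { refl  = inj₁ ≡.refl
    ; sym   = λ { (inj₁ ≡.refl) → inj₁ ≡.refl ; (inj₂ ≡.refl) → inj₂ ≡.refl }
    ; trans = λ { (inj₁ ≡.refl) q → q ; (inj₂ ≡.refl) (inj₁ ≡.refl) → inj₂ ≡.refl
                ; (inj₂ ≡.refl) (inj₂ ≡.refl) → inj₁ ≡.refl }
    }
  }

record Graph (n : ℕ) : Set where
  constructor mkGraph
  field
    edges : List (Edge n)

open Graph public

-- Equality of labelled graphs (not isomorphism).
_≈ᵍ_ : ∀ {n} → Graph n → Graph n → Set
_≈ᵍ_ {n} G H = edges G ↭ᵉ edges H
  where open SetoidPerm (edgeSetoid n) using () renaming (_↭_ to _↭ᵉ_)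

edgeCount : ∀ {n} {P : Fin n → Fin n → Set} → Decidable P → Graph n → ℕ
edgeCount P? G = length (filter (uncurry P?) (edges G))

Colouring : ℕ → Set
Colouring n = Vec ℕ n

monochromaticEdges : ∀ {n} → Colouring n → Graph n → ℕ
monochromaticEdges κ = edgeCount λ u v → lookup κ u ℕ.≟ lookup κ v

infixl 6 _⊎ᵍ[_]_

_⊎ᵍ[_]_ : ∀ {n N} → Graph N → n ℕ.≤ N → Graph n → Graph N
G ⊎ᵍ[ n≤N ] H = mkGraph (edges G ++ map (Product.map (λ i → inject≤ i n≤N) (λ i → inject≤ i n≤N)) (edges H))

record SetPartition (n : ℕ) : Set where
  field
    blocks   : List (Subset n)
    nonempty : All Nonempty blocks
    disjoint : AllPairs (λ b b′ → Empty (b ∩ b′)) blocks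
    covering : ∀ v → Any (v ∈ˢ_) blocks

  SameBlock : Fin n → Fin n → Set
  SameBlock u v = Any (λ b → u ∈ˢ b × v ∈ˢ b) blocks

  sameBlock? : Decidable SameBlock
  sameBlock? u v = any? (λ b → (u ∈ˢ? b) ×-dec (v ∈ˢ? b)) blocks

open SetPartition public using (SameBlock; sameBlock?)

-- A monomial in x₀, x₁, x₂, … is the list of the indices of its factors; lists
-- that are permutations of each other are the same monomial.
Monomial : Set
Monomial = List ℕ

infix 4 _↭?_

_↭?_ : Decidable {A = Monomial} _↭_
[]       ↭? []      = yes ↭-refl
[]       ↭? (y ∷ w) = no λ p → Perm.¬x∷xs↭[] (↭-sym p)
(x ∷ v) ↭? w with DecMembership._∈?_ ℕ._≟_ x w
... | no x∉w = no λ p → x∉w (∈-resp-↭ p (here ≡.refl))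
... | yes x∈w with ∈-∃++ x∈w
... | ys , zs , ≡.refl = map′
  (λ p → ↭-trans (prep x p) (↭-sym (Perm.shift x ys zs)))
  (λ p → drop-∷ (↭-trans p (Perm.shift x ys zs)))
  (v ↭? (ys ++ zs))

support : Monomial → List ℕ
support = deduplicate ℕ._≟_

colouringsIn : List ℕ → ∀ n → List (Colouring n)
colouringsIn A zero    = [ [] ]
colouringsIn A (suc n) = cartesianProductWith _∷_ A (colouringsIn A n)

-- The colourings κ with ∏ x_{κ(v)} = w, each listed once; their values
-- necessarily lie in the support of w.
colourings : ∀ n → Monomial → List (Colouring n)
colourings n w = filter (λ κ → toList κ ↭? w) (colouringsIn (support w) n)

private
  module _ {a b c} {A : Set a} {B : Set b} {C : Set c} (f : A → B → C) where
    prodˡ : ∀ {xs xs′} ys → xs ↭ xs′ → cartesianProductWith f xs ys ↭ cartesianProductWith f xs′ ys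
    prodˡ ys refl         = ↭-refl
    prodˡ ys (prep x p)   = Perm.++⁺ˡ (map (f x) ys) (prodˡ ys p)
    prodˡ ys (swap x y p) = ↭-trans (Perm.shifts (map (f x) ys) (map (f y) ys))
      (Perm.++⁺ˡ (map (f y) ys) (Perm.++⁺ˡ (map (f x) ys) (prodˡ ys p)))
    prodˡ ys (trans p q)  = ↭-trans (prodˡ ys p) (prodˡ ys q)

    prodʳ : ∀ xs {ys ys′} → ys ↭ ys′ → cartesianProductWith f xs ys ↭ cartesianProductWith f xs ys′
    prodʳ []       p = ↭-refl
    prodʳ (x ∷ xs) p = Perm.++⁺ (Perm.map⁺ (f x) p) (prodʳ xs p)

  colouringsIn-↭ : ∀ {A A′} n → A ↭ A′ → colouringsIn A n ↭ colouringsIn A′ n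
  colouringsIn-↭ zero    p = ↭-refl
  colouringsIn-↭ {A} {A′} (suc n) p = ↭-trans (prodˡ _∷_ _ p) (prodʳ _∷_ A′ (colouringsIn-↭ n p))

  prod-map : ∀ {n} (σ : ℕ → ℕ) A (κs : List (Colouring n)) →
    cartesianProductWith _∷_ (map σ A) (map (Vec.map σ) κs) ≡ map (Vec.map σ) (cartesianProductWith _∷_ A κs)
  prod-map σ []      κs = ≡.refl
  prod-map σ (a ∷ A) κs = ≡.trans
    (≡.cong₂ _++_ (≡.trans (≡.sym (List.map-∘ κs)) (List.map-∘ κs)) (prod-map σ A κs))
    (≡.sym (List.map-++ (Vec.map σ) (map (a ∷_) κs) (cartesianProductWith _∷_ A κs)))

  colouringsIn-map : ∀ (σ : ℕ → ℕ) A n → colouringsIn (map σ A) n ≡ map (Vec.map σ) (colouringsIn A n)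
  colouringsIn-map σ A zero    = ≡.refl
  colouringsIn-map σ A (suc n) = ≡.trans
    (≡.cong (cartesianProductWith _∷_ (map σ A)) (colouringsIn-map σ A n)) (prod-map σ A (colouringsIn A n))

  filter-map : ∀ {a b p} {A : Set a} {B : Set b} {P : B → Set p} (P? : ∀ y → _) (f : A → B) xs →
    filter {P = P} P? (map f xs) ≡ map f (filter (λ x → P? (f x)) xs)
  filter-map P? f []       = ≡.refl
  filter-map P? f (x ∷ xs) with P? (f x)
  ... | yes _ = ≡.cong (f x ∷_) (filter-map P? f xs)
  ... | no  _ = filter-map P? f xs

  module _ (σ : ℕ ↔ ℕ) where
    open Inverse σ using (to; from; strictlyInverseʳ)

    to-injective : ∀ {i j} → to i ≡ to j → i ≡ j
    to-injective {i} {j} eq = ≡.trans (≡.sym (strictlyInverseʳ i)) (≡.trans (≡.cong from eq) (strictlyInverseʳ j))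

    from∘to : ∀ v → map from (map to v) ≡ v
    from∘to v = ≡.trans (≡.sym (List.map-∘ v)) (≡.trans (List.map-cong strictlyInverseʳ v) (List.map-id v))

    support-↭ : ∀ {w w′} → w′ ↭ map to w → support w′ ↭ map to (support w)
    support-↭ {w} {w′} p = ∼bag⇒↭ (unique∧set⇒bag
      (DecUnique.deduplicate-! ℕ._≟_ w′)
      (Unique.map⁺ to-injective (DecUnique.deduplicate-! ℕ._≟_ w))
      (mk⇔ fwd bwd))
      where
      fwd : ∀ {x} → x ∈ support w′ → x ∈ map to (support w)
      fwd q with ∈-map⁻ to (∈-resp-↭ p (∈-deduplicate⁻ ℕ._≟_ w′ q))
      ... | y , y∈w , ≡.refl = ∈-map⁺ to (∈-deduplicate⁺ ℕ._≟_ y∈w)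
      bwd : ∀ {x} → x ∈ map to (support w) → x ∈ support w′
      bwd q with ∈-map⁻ to q
      ... | y , y∈w , ≡.refl =
        ∈-deduplicate⁺ ℕ._≟_ (∈-resp-↭ (↭-sym p) (∈-map⁺ to (∈-deduplicate⁻ ℕ._≟_ w y∈w)))

    colourings-↭ : ∀ {w w′} n → w′ ↭ map to w → colourings n w′ ↭ map (Vec.map to) (colourings n w)
    colourings-↭ {w} {w′} n p = ↭-trans
      (filter-↭ _ (↭-trans (colouringsIn-↭ n (support-↭ p)) (↭-reflexive (colouringsIn-map to (support w) n))))
      (↭-reflexive (≡.trans (filter-map (λ κ → toList κ ↭? w′) (Vec.map to) (colouringsIn (support w) n))
        (≡.cong (map (Vec.map to)) (List.filter-≐ _ _ ((λ {κ} → fwd κ) , (λ {κ} → bwd κ)) (colouringsIn (support w) n)))))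
      where
      fwd : ∀ (κ : Colouring n) → toList (Vec.map to κ) ↭ w′ → toList κ ↭ w
      fwd κ q = ≡.subst₂ _↭_ (≡.trans (≡.cong (map from) (Vec.toList-map to κ)) (from∘to (toList κ))) (from∘to w)
        (Perm.map⁺ from (↭-trans q p))
      bwd : ∀ (κ : Colouring n) → toList κ ↭ w → toList (Vec.map to κ) ↭ w′
      bwd κ q = ↭-trans (↭-reflexive (Vec.toList-map to κ)) (↭-trans (Perm.map⁺ to q) (↭-sym p))

    monochromaticEdges-map : ∀ {n} (κ : Colouring n) G →
      monochromaticEdges (Vec.map to κ) G ≡ monochromaticEdges κ G
    monochromaticEdges-map κ G = ≡.cong length (List.filter-≐ _ _
      ( (λ { {u , v} q → to-injective (≡.trans (≡.sym (Vec.lookup-map u to κ)) (≡.trans q (Vec.lookup-map v to κ))) })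
      , (λ { {u , v} q → ≡.trans (Vec.lookup-map u to κ) (≡.trans (≡.cong to q) (≡.sym (Vec.lookup-map v to κ))) }))
      (edges G))

  colourings-long : ∀ n w → n ℕ.< length w → colourings n w ≡ []
  colourings-long n w n<w = List.filter-none (λ κ → toList κ ↭? w)
    (All.universal (λ κ p → ℕ.<⇒≢ n<w (≡.trans (≡.sym (Vec.length-toList κ)) (↭-length p))) (colouringsIn (support w) n))

-- Everything below makes sense over any commutative ring of scalars; the last
-- line takes ℂ.
module Tutte {c ℓ : Level} (K : CommutativeRing c ℓ) where

  open CommutativeRing K using (Carrier; _≈_; _+_; _*_; 0#; 1#)
  private module K = CommutativeRing K

  -- Polynomials in t, as lists of coefficients starting with the constant term.

  Poly : Set c
  Poly = List Carrier

  coeff : Poly → ℕ → Carrier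
  coeff []      _       = 0#
  coeff (a ∷ p) zero    = a
  coeff (a ∷ p) (suc k) = coeff p k

  infix  4 _≈ᵖ_
  infixl 6 _+ᵖ_
  infixl 7 _*ᵖ_ _·ᵖ_
  infixr 8 _^ᵖ_

  record _≈ᵖ_ (p q : Poly) : Set ℓ where
    constructor mk≈
    field
      coeff≈ : ∀ k → coeff p k ≈ coeff q k

  open _≈ᵖ_ public

  0ᵖ 1ᵖ 1+t : Poly
  0ᵖ  = []
  1ᵖ  = 1# ∷ []
  1+t = 1# ∷ 1# ∷ []

  _+ᵖ_ : Poly → Poly → Poly
  []      +ᵖ q       = q
  (a ∷ p) +ᵖ []      = a ∷ p
  (a ∷ p) +ᵖ (b ∷ q) = (a + b) ∷ (p +ᵖ q)

  _·ᵖ_ : Carrier → Poly → Poly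
  a ·ᵖ p = map (a *_) p

  _*ᵖ_ : Poly → Poly → Poly
  []      *ᵖ q = 0ᵖ
  (a ∷ p) *ᵖ q = a ·ᵖ q +ᵖ (0# ∷ (p *ᵖ q))

  _^ᵖ_ : Poly → ℕ → Poly
  p ^ᵖ zero  = 1ᵖ
  p ^ᵖ suc n = p *ᵖ (p ^ᵖ n)

  Σᵖ : List Poly → Poly
  Σᵖ = foldr _+ᵖ_ 0ᵖ

  coeff-+ : ∀ p q k → coeff (p +ᵖ q) k ≈ coeff p k + coeff q k
  coeff-+ []      q       k       = K.sym (K.+-identityˡ _)
  coeff-+ (a ∷ p) []      k       = K.sym (K.+-identityʳ _)
  coeff-+ (a ∷ p) (b ∷ q) zero    = K.refl
  coeff-+ (a ∷ p) (b ∷ q) (suc k) = coeff-+ p q k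

  coeff-· : ∀ a p k → coeff (a ·ᵖ p) k ≈ a * coeff p k
  coeff-· a []      k       = K.sym (K.zeroʳ a)
  coeff-· a (b ∷ p) zero    = K.refl
  coeff-· a (b ∷ p) (suc k) = coeff-· a p k

  +ᵖ-isCommutativeMonoid : IsCommutativeMonoid _≈ᵖ_ _+ᵖ_ 0ᵖ
  +ᵖ-isCommutativeMonoid = isCommutativeMonoidˡ record
    { isSemigroup = record
      { isMagma = record
        { isEquivalence = record
          { refl  = mk≈ λ k → K.refl
          ; sym   = λ p → mk≈ λ k → K.sym (coeff≈ p k)
          ; trans = λ p q → mk≈ λ k → K.trans (coeff≈ p k) (coeff≈ q k)
          }
        ; ∙-cong = λ {p} {p′} {q} {q′} e f → mk≈ λ k → K.trans (coeff-+ p q k)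
            (K.trans (K.+-cong (coeff≈ e k) (coeff≈ f k)) (K.sym (coeff-+ p′ q′ k)))
        }
      ; assoc = λ p q r → mk≈ λ k → K.trans (coeff-+ (p +ᵖ q) r k)
          (K.trans (K.+-congʳ (coeff-+ p q k)) (K.trans (K.+-assoc _ _ _)
            (K.sym (K.trans (coeff-+ p (q +ᵖ r) k) (K.+-congˡ (coeff-+ q r k))))))
      }
    ; identityˡ = λ p → mk≈ λ k → K.refl
    ; comm = λ p q → mk≈ λ k → K.trans (coeff-+ p q k) (K.trans (K.+-comm _ _) (K.sym (coeff-+ q p k)))
    }

  +ᵖ-commutativeMonoid : CommutativeMonoid c ℓ
  +ᵖ-commutativeMonoid = record { isCommutativeMonoid = +ᵖ-isCommutativeMonoid }

  private module P = CommutativeMonoid +ᵖ-commutativeMonoid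

  *ᵖ-congˡ : ∀ p {q q′} → q ≈ᵖ q′ → p *ᵖ q ≈ᵖ p *ᵖ q′
  *ᵖ-congˡ []      e = P.refl
  *ᵖ-congˡ (a ∷ p) {q} {q′} e = P.∙-cong {a ·ᵖ q} {a ·ᵖ q′} {0# ∷ p *ᵖ q} {0# ∷ p *ᵖ q′}
    (mk≈ λ k → K.trans (coeff-· a q k) (K.trans (K.*-congˡ (coeff≈ e k)) (K.sym (coeff-· a q′ k))))
    (mk≈ λ { zero → K.refl ; (suc k) → coeff≈ (*ᵖ-congˡ p e) k })

  *ᵖ-zeroʳ : ∀ p → p *ᵖ 0ᵖ ≈ᵖ 0ᵖ
  *ᵖ-zeroʳ []      = P.refl
  *ᵖ-zeroʳ (a ∷ p) = mk≈ λ { zero → K.refl ; (suc k) → coeff≈ (*ᵖ-zeroʳ p) k }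

  Σᵖ-↭ : ∀ {ps qs} → ps ↭ qs → Σᵖ ps ≈ᵖ Σᵖ qs
  Σᵖ-↭ p = SetoidPermProperties.foldr-commMonoid P.setoid +ᵖ-isCommutativeMonoid (↭⇒↭ₛ′ P.isEquivalence p)

  -- Polynomials in t over the ring of symmetric functions, through their
  -- coefficients at the monomials in x. By symmetry and bounded degree, only
  -- finitely many of these are independent, so the degree in t is bounded too.
  record Λ[t] : Set (c ⊔ ℓ) where
    field
      at        : Monomial → Poly
      at-cong   : ∀ {w w′} → w ↭ w′ → at w ≈ᵖ at w′
      symmetric : ∀ (σ : ℕ ↔ ℕ) w → at (map (Inverse.to σ) w) ≈ᵖ at w
      degree    : ℕ
      bounded   : ∀ w → degree ℕ.< length w → at w ≈ᵖ 0ᵖ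

  open Λ[t] public using (at)

  infix  4 _≈ˢ_
  infixl 6 _+ˢ_
  infixl 7 _·ˢ_

  _≈ˢ_ : Λ[t] → Λ[t] → Set ℓ
  f ≈ˢ g = ∀ w → at f w ≈ᵖ at g w

  0ˢ : Λ[t]
  0ˢ = record
    { at = λ _ → 0ᵖ
    ; at-cong = λ _ → P.refl
    ; symmetric = λ _ _ → P.refl
    ; degree = 0
    ; bounded = λ _ _ → P.refl
    }

  _+ˢ_ : Λ[t] → Λ[t] → Λ[t]
  f +ˢ g = record
    { at = λ w → f.at w +ᵖ g.at w
    ; at-cong = λ p → P.∙-cong (f.at-cong p) (g.at-cong p)
    ; symmetric = λ σ w → P.∙-cong (f.symmetric σ w) (g.symmetric σ w)
    ; degree = f.degree ℕ.⊔ g.degree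
    ; bounded = λ w lt → P.∙-cong (f.bounded w (ℕ.m⊔n<o⇒m<o f.degree g.degree lt))
                                  (g.bounded w (ℕ.m⊔n<o⇒n<o f.degree g.degree lt))
    }
    where module f = Λ[t] f
          module g = Λ[t] g

  _·ˢ_ : Poly → Λ[t] → Λ[t]
  p ·ˢ f = record
    { at = λ w → p *ᵖ f.at w
    ; at-cong = λ e → *ᵖ-congˡ p (f.at-cong e)
    ; symmetric = λ σ w → *ᵖ-congˡ p (f.symmetric σ w)
    ; degree = f.degree
    ; bounded = λ w lt → P.trans (*ᵖ-congˡ p (f.bounded w lt)) (*ᵖ-zeroʳ p)
    }
    where module f = Λ[t] f

  weight : ∀ {n} → Graph n → Colouring n → Poly
  weight G κ = 1+t ^ᵖ monochromaticEdges κ G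

  -- The coefficient at w of Σ_κ (1+t)^e(κ) ∏ x_{κ(v)}.
  XBᵍ-at : ∀ {n} → Graph n → Monomial → Poly
  XBᵍ-at {n} G w = Σᵖ (map (weight G) (colourings n w))

  private
    XBᵍ-at-↭ : ∀ {n} (G : Graph n) (σ : ℕ ↔ ℕ) {w w′} → w′ ↭ map (Inverse.to σ) w → XBᵍ-at G w′ ≈ᵖ XBᵍ-at G w
    XBᵍ-at-↭ {n} G σ {w} p = P.trans (Σᵖ-↭ (Perm.map⁺ (weight G) (colourings-↭ σ n p)))
      (P.reflexive (≡.cong Σᵖ (≡.trans (≡.sym (List.map-∘ (colourings n w)))
        (List.map-cong (λ κ → ≡.cong (1+t ^ᵖ_) (monochromaticEdges-map σ κ G)) (colourings n w)))))

  XBᵍ : ∀ {n} → Graph n → Λ[t]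
  XBᵍ {n} G = record
    { at = XBᵍ-at G
    ; at-cong = λ {w} {w′} p → XBᵍ-at-↭ G (↔-id ℕ) (↭-trans p (↭-reflexive (≡.sym (List.map-id w′))))
    ; symmetric = λ σ w → XBᵍ-at-↭ G σ ↭-refl
    ; degree = n
    ; bounded = λ w lt → P.reflexive (≡.cong (Σᵖ ∘ map (weight G)) (colourings-long n w lt))
    }

  -- A list of pairs denotes the formal sum of its entries, possibly with repeated
  -- graphs.

  Combination : ℕ → Set c
  Combination n = List (Poly × Graph n)

  𝔾[t] : Set c
  𝔾[t] = List (Poly × (∃[ n ] NonZero n × Graph n))

  XB : 𝔾[t] → Λ[t]
  XB = foldr (λ { (p , _ , _ , G) f → p ·ˢ XBᵍ G +ˢ f }) 0ˢ

  Ker-XB : 𝔾[t] → Set ℓ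
  Ker-XB L = XB L ≈ˢ 0ˢ

  Ext : ∀ {n N} .{{_ : NonZero n}} → Combination n → n ℕ.≤ N → Graph N → 𝔾[t]
  Ext {n} {N} L n≤N G = map (λ { (p , H) → p , N , N≢0 , G ⊎ᵍ[ n≤N ] H }) L
    where
    N≢0 : NonZero N
    N≢0 = ℕ.>-nonZero (ℕ.<-≤-trans (ℕ.>-nonZero⁻¹ n) n≤N)

  IsModularRelation : ∀ {n} .{{_ : NonZero n}} → Combination n → Set ℓ
  IsModularRelation {n} L = ∀ {N} (n≤N : n ℕ.≤ N) (G : Graph N) → Ker-XB (Ext L n≤N G)

  record TutteStandardForm (n : ℕ) : Set c where
    field
      k        : ℕ
      scalar   : Fin k → Carrier
      exponent : Fin k → ℕ
      graph    : Fin k → Graph n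
      distinct : ∀ {i j} → i ≢ j → ¬ (exponent i ≡ exponent j × graph i ≈ᵍ graph j)

  ⟦_⟧ : ∀ {n} → TutteStandardForm n → Combination n
  ⟦ L ⟧ = tabulate λ i → scalar i ·ᵖ 1+t ^ᵖ exponent i , graph i
    where open TutteStandardForm L

  B : ∀ {n} → TutteStandardForm n → SetPartition n → Poly
  B L π = Σᵖ (tabulate λ i → scalar i ·ᵖ 1+t ^ᵖ (exponent i ℕ.+ edgeCount (sameBlock? π) (graph i)))
    where open TutteStandardForm L

open Tutte ℂ-commutativeRing public

{-# OPTIONS --safe #-}
module Submission where

-- The coefficient of XB(Ext(L;G)) at a monomial is Σ_κ (1+t)^{e_G(κ)} B(L;π_κ),
-- where κ ranges over the colourings of [N] with that monomial and π_κ is the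
-- partition of [n] into colour classes; this gives one direction. Conversely,
-- for a partition π let G consist of M copies of every pair of vertices in a
-- common block, with M larger than the degree of every B(L;·), and take the
-- monomial of the colouring whose colour classes are the blocks of π. The number
-- of pairs u, v with κ(u) = κ(v) depends only on the monomial, so a κ making
-- every edge of G monochromatic has π_κ = π; every other κ contributes a
-- polynomial of degree less than e(G). Hence a positive multiple of
-- (1+t)^{e(G)} B(L;π) has degree less than e(G), which forces B(L;π) = 0.

open import Algebra.Bundles using (CommutativeRing; CommutativeMonoid)
import Algebra.Properties.CommutativeSemigroup as CommutativeSemigroupProperties
import Algebra.Properties.Semiring.Mult as SemiringMult
open import Data.Fin.Base using (Fin; toℕ; inject≤)
import Data.Fin.Properties as Fin
open import Data.Fin.Subset using (Subset; Empty; _∩_) renaming (_∈_ to _∈ˢ_)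
open import Data.Fin.Subset.Properties using (x∈p∩q⁺; x∈p∩q⁻)
open import Data.List.Base
  using (List; []; _∷_; _++_; map; concat; replicate; length; filter; tabulate; allFin; cartesianProduct)
import Data.List.Properties as List
open import Data.List.Membership.Propositional using (_∈_)
open import Data.List.Membership.Propositional.Properties
  using (∈-∃++; ∈-deduplicate⁺; ∈-deduplicate⁻; ∈-filter⁺; ∈-filter⁻; ∈-allFin; ∈-tabulate⁺; ∈-tabulate⁻;
         ∈-cartesianProduct⁺; ∈-cartesianProductWith⁺)
open import Data.List.Relation.Binary.Permutation.Propositional
  using (_↭_; ↭-refl; ↭-sym; ↭-trans; refl; prep; swap; trans)
import Data.List.Relation.Binary.Permutation.Propositional.Properties as Perm
open import Data.List.Relation.Unary.All as All using (All)
import Data.List.Relation.Unary.All.Properties as All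
open import Data.List.Relation.Unary.AllPairs as AllPairs using (AllPairs; _∷_)
import Data.List.Relation.Unary.AllPairs.Properties as AllPairs
open import Data.List.Relation.Unary.Any as Any using (Any; here; there; index)
import Data.List.Relation.Unary.Any.Properties as Any
import Data.List.Relation.Unary.Unique.DecPropositional.Properties as DecUnique
open import Data.Nat.Base as ℕ using (ℕ; zero; suc; NonZero; z≤n; s≤s)
import Data.Nat.Properties as ℕ
open import Data.Product.Base as Product using (∃-syntax; _×_; _,_; proj₁; proj₂; uncurry)
open import Data.Rational.Base as ℚ using (0ℚ; 1ℚ)
import Data.Rational.Properties as ℚ
open import Data.Sum.Base using (_⊎_; inj₁; inj₂)
open import Data.Vec.Base as Vec using (Vec; []; _∷_; lookup; toList)
import Data.Vec.Properties as Vec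
open import Function.Base using (_∘_)
open import Function.Bundles using (_⇔_; mk⇔)
open import Level using (Level; _⊔_)
open import Relation.Binary.Definitions using (Decidable)
open import Relation.Binary.PropositionalEquality as ≡ using (_≡_)
open import Relation.Nullary.Decidable using (yes; no; does; dec-true; dec-false)
open import Relation.Nullary.Negation using (contradiction)
import Relation.Binary.Reasoning.Setoid as ≈-Reasoning
import Relation.Unary as Unary
open import Defs
  using (ℝ; _≈ʳ_; constant; ℝ-commutativeRing; ℂ-commutativeRing; module Adjoin-i; Graph; mkGraph; edges; edgeCount;
         Colouring; monochromaticEdges; _⊎ᵍ[_]_; SetPartition; SameBlock; sameBlock?; _↭?_; support; colouringsIn;
         colourings; module Tutte)

private
  variable
    a b p q : Level
    A : Set a
    C : Set b

-- Counting in filtered lists and Cartesian products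

filter-filter : {P : Unary.Pred A p} {Q : Unary.Pred A q} (P? : Unary.Decidable P) (Q? : Unary.Decidable Q) →
  Q Unary.⊆ P → ∀ xs → filter Q? (filter P? xs) ≡ filter Q? xs
filter-filter P? Q? Q⊆P []       = ≡.refl
filter-filter P? Q? Q⊆P (x ∷ xs) with P? x
... | yes _  with Q? x
...   | yes _ = ≡.cong (x ∷_) (filter-filter P? Q? Q⊆P xs)
...   | no  _ = filter-filter P? Q? Q⊆P xs
filter-filter P? Q? Q⊆P (x ∷ xs) | no ¬p with Q? x
...   | yes q = contradiction (Q⊆P q) ¬p
...   | no  _ = filter-filter P? Q? Q⊆P xs

length-filter-full : {P : Unary.Pred A p} (P? : Unary.Decidable P) → ∀ xs →
  length (filter P? xs) ≡ length xs → All P xs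
length-filter-full {P = P} P? xs eq = ≡.subst (All P) (List.filter-complete P? eq) (All.all-filter P? xs)

-- Filtering by `Q?` what `P?` has kept loses no entry, because the counts agree; so every entry
-- kept by `P?` satisfies `Q`.
filter-⊆-length : {P : Unary.Pred A p} {Q : Unary.Pred A q} (P? : Unary.Decidable P) (Q? : Unary.Decidable Q) →
  Q Unary.⊆ P → ∀ xs → length (filter Q? xs) ≡ length (filter P? xs) → ∀ {x} → x ∈ xs → P x → Q x
filter-⊆-length P? Q? Q⊆P xs eq x∈xs px = All.lookup
  (length-filter-full Q? (filter P? xs) (≡.trans (≡.cong length (filter-filter P? Q? Q⊆P xs)) eq))
  (∈-filter⁺ P? x∈xs px)

length-filter-map : {P : Unary.Pred C p} (P? : Unary.Decidable P) (f : A → C) → ∀ xs →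
  length (filter P? (map f xs)) ≡ length (filter (P? ∘ f) xs)
length-filter-map P? f []       = ≡.refl
length-filter-map P? f (x ∷ xs) with P? (f x)
... | yes _ = ≡.cong suc (length-filter-map P? f xs)
... | no  _ = length-filter-map P? f xs

length-filter-++ : {P : Unary.Pred A p} (P? : Unary.Decidable P) → ∀ xs ys →
  length (filter P? (xs ++ ys)) ≡ length (filter P? xs) ℕ.+ length (filter P? ys)
length-filter-++ P? xs ys = ≡.trans (≡.cong length (List.filter-++ P? xs ys)) (List.length-++ (filter P? xs))

length-filter-copies : {P : Unary.Pred A p} (P? : Unary.Decidable P) → ∀ m xs →
  length (filter P? (concat (replicate m xs))) ≡ m ℕ.* length (filter P? xs)
length-filter-copies P? zero    xs = ≡.refl
length-filter-copies P? (suc m) xs = ≡.trans (length-filter-++ P? xs (concat (replicate m xs)))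
  (≡.cong (length (filter P? xs) ℕ.+_) (length-filter-copies P? m xs))

cartesianProduct-map : ∀ (f : A → C) xs ys →
  cartesianProduct (map f xs) (map f ys) ≡ map (Product.map f f) (cartesianProduct xs ys)
cartesianProduct-map f []       ys = ≡.refl
cartesianProduct-map f (x ∷ xs) ys = ≡.trans
  (≡.cong₂ _++_ (≡.trans (≡.sym (List.map-∘ ys)) (List.map-∘ ys)) (cartesianProduct-map f xs ys))
  (≡.sym (List.map-++ (Product.map f f) (map (x ,_) ys) (cartesianProduct xs ys)))

cartesianProduct-↭ : ∀ {xs xs′ : List A} {ys ys′ : List C} → xs ↭ xs′ → ys ↭ ys′ →
  cartesianProduct xs ys ↭ cartesianProduct xs′ ys′
cartesianProduct-↭ {xs′ = xs′} {ys = ys} p q = ↭-trans (left p) (right xs′)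
  where
  left : ∀ {xs xs′} → xs ↭ xs′ → cartesianProduct xs ys ↭ cartesianProduct xs′ ys
  left refl         = ↭-refl
  left (prep x p)   = Perm.++⁺ˡ (map (x ,_) ys) (left p)
  left (swap x y p) = ↭-trans (Perm.shifts (map (x ,_) ys) (map (y ,_) ys))
    (Perm.++⁺ˡ (map (y ,_) ys) (Perm.++⁺ˡ (map (x ,_) ys) (left p)))
  left (trans p p′) = ↭-trans (left p) (left p′)
  right : ∀ xs → cartesianProduct xs ys ↭ cartesianProduct xs _
  right []       = ↭-refl
  right (x ∷ xs) = Perm.++⁺ (Perm.map⁺ (x ,_) q) (right xs)

-- Colourings and set partitions

edgeCount-cong : ∀ {n} {P Q : Fin n → Fin n → Set} (P? : Decidable P) (Q? : Decidable Q) →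
  (∀ u v → P u v → Q u v) → (∀ u v → Q u v → P u v) → ∀ H → edgeCount P? H ≡ edgeCount Q? H
edgeCount-cong P? Q? P⊆Q Q⊆P H = ≡.cong length
  (List.filter-≐ (uncurry P?) (uncurry Q?) ((λ {e} → uncurry P⊆Q e) , (λ {e} → uncurry Q⊆P e)) (edges H))

-- The first summand does not depend on `H`, so in `XB-Ext` the corresponding power of 1+t factors
-- out of the sum over the terms of the combination.
monochromaticEdges-⊎ : ∀ {n N} (κ : Colouring N) G (n≤N : n ℕ.≤ N) H →
  monochromaticEdges κ (G ⊎ᵍ[ n≤N ] H) ≡
  monochromaticEdges κ G ℕ.+ edgeCount (λ u v → lookup κ (inject≤ u n≤N) ℕ.≟ lookup κ (inject≤ v n≤N)) H
monochromaticEdges-⊎ κ G n≤N H = ≡.trans (length-filter-++ _ (edges G) _)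
  (≡.cong (monochromaticEdges κ G ℕ.+_) (length-filter-map _ _ (edges H)))

-- Ordered pairs together with the diagonal: a colouring maps this list onto the full Cartesian
-- square of its list of values.
allPairs : ∀ n → List (Fin n × Fin n)
allPairs n = cartesianProduct (allFin n) (allFin n)

∈-allPairs : ∀ {n} (e : Fin n × Fin n) → e ∈ allPairs n
∈-allPairs (u , v) = ∈-cartesianProduct⁺ (∈-allFin u) (∈-allFin v)

toList-tabulate : ∀ {n} (κ : Vec A n) → toList κ ≡ map (lookup κ) (allFin n)
toList-tabulate κ = ≡.trans (go κ) (≡.sym (List.map-tabulate (λ i → i) (lookup κ)))
  where
  go : ∀ {n} (κ : Vec _ n) → toList κ ≡ tabulate (lookup κ)
  go []      = ≡.refl
  go (x ∷ κ) = ≡.cong (x ∷_) (go κ)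

-- Monochromatic pairs are the entries with equal components in the Cartesian square of `toList κ`,
-- and permuting a list only permutes its square.
monochromaticPairs-↭ : ∀ {n} (κ κ′ : Colouring n) → toList κ ↭ toList κ′ →
  monochromaticEdges κ (mkGraph (allPairs n)) ≡ monochromaticEdges κ′ (mkGraph (allPairs n))
monochromaticPairs-↭ {n} κ κ′ κ↭κ′ = ≡.trans (count κ)
  (≡.trans (Perm.↭-length (Perm.filter-↭ eq? (cartesianProduct-↭ κ↭κ′ κ↭κ′))) (≡.sym (count κ′)))
  where
  eq? = uncurry ℕ._≟_
  count : ∀ κ → monochromaticEdges κ (mkGraph (allPairs n)) ≡
    length (filter eq? (cartesianProduct (toList κ) (toList κ)))
  count κ = ≡.trans (≡.sym (length-filter-map eq? _ (allPairs n))) (≡.cong (length ∘ filter eq?)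
    (≡.trans (≡.sym (cartesianProduct-map (lookup κ) (allFin n) (allFin n)))
      (≡.sym (≡.cong₂ cartesianProduct (toList-tabulate κ) (toList-tabulate κ)))))

∈-colouringsIn : ∀ {n} {S : List ℕ} (κ : Colouring n) → (∀ {c} → c ∈ toList κ → c ∈ S) → κ ∈ colouringsIn S n
∈-colouringsIn []      _   = here ≡.refl
∈-colouringsIn (c ∷ κ) κ⊆S = ∈-cartesianProductWith⁺ _∷_ (κ⊆S (here ≡.refl)) (∈-colouringsIn κ (κ⊆S ∘ there))

∈-colourings : ∀ {n} (κ : Colouring n) → κ ∈ colourings n (toList κ)
∈-colourings κ = ∈-filter⁺ (λ κ′ → toList κ′ ↭? toList κ) (∈-colouringsIn κ (∈-deduplicate⁺ ℕ._≟_)) ↭-refl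

module _ {n} (f : Fin n → ℕ) where

  private
    fibre : ℕ → Subset n
    fibre c = Vec.tabulate λ v → does (f v ℕ.≟ c)

    ∈-fibre⁺ : ∀ {v c} → f v ≡ c → v ∈ˢ fibre c
    ∈-fibre⁺ {v} {c} eq = Vec.lookup⇒[]= v _ (≡.trans (Vec.lookup∘tabulate _ v) (dec-true (f v ℕ.≟ c) eq))

    ∈-fibre⁻ : ∀ {v c} → v ∈ˢ fibre c → f v ≡ c
    ∈-fibre⁻ {v} {c} v∈ with f v ℕ.≟ c
    ... | yes eq  = eq
    ... | no  ¬eq = contradiction
      (≡.trans (≡.sym (dec-false (f v ℕ.≟ c) ¬eq)) (≡.trans (≡.sym (Vec.lookup∘tabulate _ v)) (Vec.[]=⇒lookup v∈))) λ ()

    -- Only colours that occur are listed, which keeps the blocks nonempty, and each is listed once,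
    -- which keeps them disjoint.
    values : List ℕ
    values = support (tabulate f)

    f∈values : ∀ v → f v ∈ values
    f∈values v = ∈-deduplicate⁺ ℕ._≟_ (∈-tabulate⁺ v)

    occurring : ∀ {c} → c ∈ values → ∃[ v ] v ∈ˢ fibre c
    occurring c∈ with ∈-tabulate⁻ (∈-deduplicate⁻ ℕ._≟_ (tabulate f) c∈)
    ... | v , eq = v , ∈-fibre⁺ (≡.sym eq)

  fibres : SetPartition n
  fibres = record
    { blocks   = map fibre values
    ; nonempty = All.map⁺ (All.tabulate occurring)
    ; disjoint = AllPairs.map⁺ (AllPairs.map
        (λ {c} {c′} c≢c′ (v , v∈) → let v∈c , v∈c′ = x∈p∩q⁻ (fibre c) (fibre c′) v∈
                                     in c≢c′ (≡.trans (≡.sym (∈-fibre⁻ v∈c)) (∈-fibre⁻ v∈c′)))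
        (DecUnique.deduplicate-! ℕ._≟_ (tabulate f)))
    ; covering = λ v → Any.map⁺ (Any.map (λ eq → ∈-fibre⁺ eq) (f∈values v))
    }

  fibres-SameBlock⁺ : ∀ {u v} → f u ≡ f v → SameBlock fibres u v
  fibres-SameBlock⁺ {u} {v} eq = Any.map⁺ (Any.map
    (λ eq′ → ∈-fibre⁺ eq′ , ∈-fibre⁺ (≡.trans (≡.sym eq) eq′))
    (f∈values u))

  fibres-SameBlock⁻ : ∀ {u v} → SameBlock fibres u v → f u ≡ f v
  fibres-SameBlock⁻ s with Any.satisfied (Any.map⁻ s)
  ... | _ , u∈c , v∈c = ≡.trans (∈-fibre⁻ u∈c) (≡.sym (∈-fibre⁻ v∈c))

module _ {n} (π : SetPartition n) where

  open SetPartition π using (blocks; disjoint; covering)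

  private
    -- Two different positions would put `v` into the intersection of two disjoint blocks. Hence the
    -- number of the block of a vertex does not depend on the proof of membership.
    index-unique : ∀ {bs : List (Subset n)} {v} → AllPairs (λ b b′ → Empty (b ∩ b′)) bs →
      (p q : Any (v ∈ˢ_) bs) → index p ≡ index q
    index-unique (_ ∷ _)  (here _)   (here _)   = ≡.refl
    index-unique (d ∷ _)  (here v∈b) (there q)  =
      contradiction (_ , x∈p∩q⁺ (v∈b , proj₂ (All.lookupAny d q))) (proj₁ (All.lookupAny d q))
    index-unique (d ∷ _)  (there p)  (here v∈b) =
      contradiction (_ , x∈p∩q⁺ (v∈b , proj₂ (All.lookupAny d p))) (proj₁ (All.lookupAny d p))
    index-unique (_ ∷ ds) (there p)  (there q)  = ≡.cong Fin.suc (index-unique ds p q)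

    index-map : ∀ {P Q : Subset n → Set} {bs} (f : ∀ {b} → P b → Q b) (p : Any P bs) → index (Any.map f p) ≡ index p
    index-map f (here _)  = ≡.refl
    index-map f (there p) = ≡.cong Fin.suc (index-map f p)

    any-zip : ∀ {P Q : Subset n → Set} {bs} (p : Any P bs) (q : Any Q bs) → index p ≡ index q →
      Any (λ b → P b × Q b) bs
    any-zip (here p)  (here q)  _  = here (p , q)
    any-zip (there p) (there q) eq = there (any-zip p q (Fin.suc-injective eq))

  blockColouring : Colouring n
  blockColouring = Vec.tabulate λ v → toℕ (index (covering v))

  private
    lookup-blockColouring : ∀ v → lookup blockColouring v ≡ toℕ (index (covering v))
    lookup-blockColouring = Vec.lookup∘tabulate _

  blockColouring-SameBlock⁺ : ∀ {u v} → SameBlock π u v → lookup blockColouring u ≡ lookup blockColouring v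
  blockColouring-SameBlock⁺ {u} {v} s = ≡.trans (lookup-blockColouring u)
    (≡.trans (≡.cong toℕ eq) (≡.sym (lookup-blockColouring v)))
    where
    eq : index (covering u) ≡ index (covering v)
    -- Both projections of `s` sit at the position of the common block; uniqueness identifies it
    -- with the positions that `covering` returns for `u` and `v`.
    eq = ≡.trans (index-unique disjoint (covering u) (Any.map proj₁ s))
      (≡.trans (≡.trans (index-map proj₁ s) (≡.sym (index-map proj₂ s)))
        (index-unique disjoint (Any.map proj₂ s) (covering v)))

  blockColouring-SameBlock⁻ : ∀ {u v} → lookup blockColouring u ≡ lookup blockColouring v → SameBlock π u v
  blockColouring-SameBlock⁻ {u} {v} eq = any-zip (covering u) (covering v)
    (Fin.toℕ-injective (≡.trans (≡.sym (lookup-blockColouring u)) (≡.trans eq (lookup-blockColouring v))))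

  -- The edges of which the test graph takes `M` copies. Loops and both orders of a pair are kept,
  -- so that the count compares directly with one over `allPairs`.
  blockPairs : List (Fin n × Fin n)
  blockPairs = filter (uncurry (sameBlock? π)) (allPairs n)

  -- A colouring with the same content has as many monochromatic pairs of
  -- vertices as π has pairs inside blocks, so it cannot merge blocks without
  -- splitting others.
  blockPairs-monochromatic : ∀ κ → toList κ ↭ toList blockColouring →
    monochromaticEdges κ (mkGraph blockPairs) ≡ length blockPairs →
    ∀ {u v} → (SameBlock π u v → lookup κ u ≡ lookup κ v) × (lookup κ u ≡ lookup κ v → SameBlock π u v)
  blockPairs-monochromatic κ κ↭ full = respects _ ,
    filter-⊆-length mono? same? (λ {e} → respects e) (allPairs n) counts (∈-allPairs _)
    where
    mono? : Unary.Decidable (uncurry λ u v → lookup κ u ≡ lookup κ v)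
    mono? (u , v) = lookup κ u ℕ.≟ lookup κ v
    same? = uncurry (sameBlock? π)
    respects : ∀ ((u , v) : Fin n × Fin n) → SameBlock π u v → lookup κ u ≡ lookup κ v
    respects e s = All.lookup (length-filter-full mono? blockPairs full) (∈-filter⁺ same? (∈-allPairs e) s)
    counts : length blockPairs ≡ length (filter mono? (allPairs n))
    -- The pairs inside blocks are exactly the monochromatic pairs of `blockColouring`; the
    -- permutation carries their number over to `κ`.
    counts = ≡.trans
      (edgeCount-cong (sameBlock? π) (λ u v → lookup blockColouring u ℕ.≟ lookup blockColouring v)
        (λ _ _ → blockColouring-SameBlock⁺) (λ _ _ → blockColouring-SameBlock⁻) (mkGraph (allPairs n)))
      (≡.sym (monochromaticPairs-↭ κ blockColouring κ↭))

module TutteProperties {c ℓ : Level} (K : CommutativeRing c ℓ) where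

  open CommutativeRing K using (Carrier; _≈_; _+_; _*_; 0#; 1#; semiring)
  open SemiringMult semiring using (×-congʳ; ×-assoc-*) renaming (_×_ to _∙_)
  open Tutte K
  private
    module K = CommutativeRing K
    module P = CommutativeMonoid +ᵖ-commutativeMonoid
    module K⁺ = CommutativeSemigroupProperties K.+-commutativeSemigroup
    module P⁺ = CommutativeSemigroupProperties P.commutativeSemigroup

  -- Powers of 1 + t

  coeff-1+t-zero : ∀ p → coeff (1+t *ᵖ p) 0 ≈ coeff p 0
  coeff-1+t-zero p = K.trans (coeff-+ (1# ·ᵖ p) _ 0)
    (K.trans (K.+-identityʳ _) (K.trans (coeff-· 1# p 0) (K.*-identityˡ _)))

  coeff-1+t-suc : ∀ p k → coeff (1+t *ᵖ p) (suc k) ≈ coeff p (suc k) + coeff p k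
  coeff-1+t-suc p k = K.trans (coeff-+ (1# ·ᵖ p) _ (suc k)) (K.+-cong
    (K.trans (coeff-· 1# p (suc k)) (K.*-identityˡ _))
    (K.trans (coeff-+ (1# ·ᵖ p) (0# ∷ []) k) (K.trans (K.+-cong
      (K.trans (coeff-· 1# p k) (K.*-identityˡ _)) (coeff-0 k)) (K.+-identityʳ _))))
    where
    -- Unfolding `*ᵖ` down to the empty list leaves the summand `0# ∷ []`, which is zero but not
    -- literally `0ᵖ`.
    coeff-0 : ∀ k → coeff (0# ∷ []) k ≈ 0#
    coeff-0 zero    = K.refl
    coeff-0 (suc k) = K.refl

  ∷-cong : ∀ {x y p q} → x ≈ y → p ≈ᵖ q → x ∷ p ≈ᵖ y ∷ q
  ∷-cong x≈y p≈q = mk≈ λ { zero → x≈y ; (suc k) → coeff≈ p≈q k }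

  ·ᵖ-distribˡ-+ᵖ : ∀ x p q → x ·ᵖ (p +ᵖ q) ≈ᵖ x ·ᵖ p +ᵖ x ·ᵖ q
  ·ᵖ-distribˡ-+ᵖ x p q = mk≈ λ k → K.trans (coeff-· x (p +ᵖ q) k) (K.trans (K.*-congˡ (coeff-+ p q k))
    (K.trans (K.distribˡ x _ _) (K.sym (K.trans (coeff-+ (x ·ᵖ p) (x ·ᵖ q) k)
      (K.+-cong (coeff-· x p k) (coeff-· x q k))))))

  *ᵖ-distribˡ-+ᵖ : ∀ p q r → p *ᵖ (q +ᵖ r) ≈ᵖ p *ᵖ q +ᵖ p *ᵖ r
  *ᵖ-distribˡ-+ᵖ []      q r = P.refl
  *ᵖ-distribˡ-+ᵖ (x ∷ p) q r = P.trans
    (P.∙-cong (·ᵖ-distribˡ-+ᵖ x q r) (∷-cong (K.sym (K.+-identityˡ 0#)) (*ᵖ-distribˡ-+ᵖ p q r)))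
    (P⁺.interchange (x ·ᵖ q) (x ·ᵖ r) (0# ∷ p *ᵖ q) (0# ∷ p *ᵖ r))

  -- Prepending `0#` is multiplication by t, so this moves a factor t out of the right argument.
  *ᵖ-shift : ∀ p q → p *ᵖ (0# ∷ q) ≈ᵖ 0# ∷ p *ᵖ q
  *ᵖ-shift []      q = mk≈ λ { zero → K.refl ; (suc k) → K.refl }
  *ᵖ-shift (x ∷ p) q = ∷-cong (K.trans (K.+-congʳ (K.zeroʳ x)) (K.+-identityˡ 0#)) (P.∙-congˡ {x ·ᵖ q} (*ᵖ-shift p q))

  1+t-*ᵖ : ∀ p → 1+t *ᵖ p ≈ᵖ p +ᵖ (0# ∷ p)
  1+t-*ᵖ p = mk≈ λ
    { zero    → K.trans (coeff-1+t-zero p) (K.sym (K.trans (coeff-+ p (0# ∷ p) 0) (K.+-identityʳ _)))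
    ; (suc k) → K.trans (coeff-1+t-suc p k) (K.sym (coeff-+ p (0# ∷ p) (suc k))) }

  *ᵖ-1+t-comm : ∀ p q → p *ᵖ (1+t *ᵖ q) ≈ᵖ 1+t *ᵖ (p *ᵖ q)
  *ᵖ-1+t-comm p q = P.trans (*ᵖ-congˡ p (1+t-*ᵖ q)) (P.trans (*ᵖ-distribˡ-+ᵖ p q (0# ∷ q))
    (P.trans (P.∙-congˡ {p *ᵖ q} (*ᵖ-shift p q)) (P.sym (1+t-*ᵖ (p *ᵖ q)))))

  ·ᵖ-1+t-comm : ∀ x p → x ·ᵖ (1+t *ᵖ p) ≈ᵖ 1+t *ᵖ (x ·ᵖ p)
  ·ᵖ-1+t-comm x p = mk≈ λ
    { zero    → K.trans (coeff-· x (1+t *ᵖ p) 0) (K.trans (K.*-congˡ (coeff-1+t-zero p))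
                  (K.sym (K.trans (coeff-1+t-zero (x ·ᵖ p)) (coeff-· x p 0))))
    ; (suc k) → K.trans (coeff-· x (1+t *ᵖ p) (suc k)) (K.trans (K.*-congˡ (coeff-1+t-suc p k))
                  (K.trans (K.distribˡ x _ _)
                  (K.sym (K.trans (coeff-1+t-suc (x ·ᵖ p) k) (K.+-cong (coeff-· x p (suc k)) (coeff-· x p k)))))) }

  *ᵖ-identityʳ : ∀ p → p *ᵖ 1ᵖ ≈ᵖ p
  *ᵖ-identityʳ []      = P.refl
  *ᵖ-identityʳ (x ∷ p) = ∷-cong (K.trans (K.+-identityʳ _) (K.*-identityʳ x)) (*ᵖ-identityʳ p)

  infixr 8 _⋆_

  -- (1+t)ⁿ p, iterated so that ⋆-+ needs no associativity of *ᵖ.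
  _⋆_ : ℕ → Poly → Poly
  zero  ⋆ p = p
  suc n ⋆ p = 1+t *ᵖ n ⋆ p

  ⋆-cong : ∀ n {p q} → p ≈ᵖ q → n ⋆ p ≈ᵖ n ⋆ q
  ⋆-cong zero    e = e
  ⋆-cong (suc n) e = *ᵖ-congˡ 1+t (⋆-cong n e)

  ⋆-distribˡ-+ᵖ : ∀ n p q → n ⋆ (p +ᵖ q) ≈ᵖ n ⋆ p +ᵖ n ⋆ q
  ⋆-distribˡ-+ᵖ zero    p q = P.refl
  ⋆-distribˡ-+ᵖ (suc n) p q = P.trans (*ᵖ-congˡ 1+t (⋆-distribˡ-+ᵖ n p q)) (*ᵖ-distribˡ-+ᵖ 1+t (n ⋆ p) (n ⋆ q))

  ⋆-zeroʳ : ∀ n → n ⋆ 0ᵖ ≈ᵖ 0ᵖ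
  ⋆-zeroʳ zero    = P.refl
  ⋆-zeroʳ (suc n) = P.trans (*ᵖ-congˡ 1+t (⋆-zeroʳ n)) (*ᵖ-zeroʳ 1+t)

  ⋆-+ : ∀ m n p → (m ℕ.+ n) ⋆ p ≡ m ⋆ n ⋆ p
  ⋆-+ zero    n p = ≡.refl
  ⋆-+ (suc m) n p = ≡.cong (1+t *ᵖ_) (⋆-+ m n p)

  -- Brings a coefficient times a colouring weight into the iterated form, by moving one factor 1+t
  -- at a time to the front.
  *ᵖ-^ᵖ : ∀ p n → p *ᵖ 1+t ^ᵖ n ≈ᵖ n ⋆ p
  *ᵖ-^ᵖ p zero    = *ᵖ-identityʳ p
  *ᵖ-^ᵖ p (suc n) = P.trans (*ᵖ-1+t-comm p (1+t ^ᵖ n)) (*ᵖ-congˡ 1+t (*ᵖ-^ᵖ p n))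

  ⋆-·ᵖ-^ᵖ : ∀ x n m → m ⋆ (x ·ᵖ 1+t ^ᵖ n) ≈ᵖ x ·ᵖ 1+t ^ᵖ (n ℕ.+ m)
  ⋆-·ᵖ-^ᵖ x n zero    rewrite ℕ.+-identityʳ n = P.refl
  ⋆-·ᵖ-^ᵖ x n (suc m) rewrite ℕ.+-suc n m =
    P.trans (*ᵖ-congˡ 1+t (⋆-·ᵖ-^ᵖ x n m)) (P.sym (·ᵖ-1+t-comm x (1+t ^ᵖ (n ℕ.+ m))))

  -- Degrees

  -- The bound is strict, so that `DegreeBelow 0` expresses vanishing; it refers to coefficients
  -- because a list may end in zeros.
  DegreeBelow : ℕ → Poly → Set ℓ
  DegreeBelow d p = ∀ {k} → d ℕ.≤ k → coeff p k ≈ 0#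

  DegreeBelow-cong : ∀ {d p q} → p ≈ᵖ q → DegreeBelow d p → DegreeBelow d q
  DegreeBelow-cong p≈q low d≤k = K.trans (K.sym (coeff≈ p≈q _)) (low d≤k)

  DegreeBelow-length : ∀ p → DegreeBelow (length p) p
  DegreeBelow-length []      _         = K.refl
  DegreeBelow-length (x ∷ p) (s≤s d≤k) = DegreeBelow-length p d≤k

  DegreeBelow-+ : ∀ {d} p q → DegreeBelow d p → DegreeBelow d q → DegreeBelow d (p +ᵖ q)
  DegreeBelow-+ p q low-p low-q d≤k = K.trans (coeff-+ p q _)
    (K.trans (K.+-cong (low-p d≤k) (low-q d≤k)) (K.+-identityˡ 0#))

  DegreeBelow-⋆ : ∀ {d} n p → DegreeBelow d p → DegreeBelow (n ℕ.+ d) (n ⋆ p)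
  DegreeBelow-⋆ zero    p low = low
  DegreeBelow-⋆ (suc n) p low (s≤s {n = k} d≤k) = K.trans (coeff-1+t-suc (n ⋆ p) k)
    (K.trans (K.+-cong (DegreeBelow-⋆ n p low (ℕ.m≤n⇒m≤1+n d≤k)) (DegreeBelow-⋆ n p low d≤k)) (K.+-identityˡ 0#))

  -- The coefficient of (1+t)p at k+1 is p(k+1) + p(k), so the p(k) vanish by
  -- downward induction from the length of p.
  DegreeBelow-1+t⁻ : ∀ {d} p → DegreeBelow (suc d) (1+t *ᵖ p) → DegreeBelow d p
  DegreeBelow-1+t⁻ {d} p low {k} = go (length p) (ℕ.m≤n+m (length p) k)
    where
    -- `gap` measures how far `k` may still lie below `length p`; each step up in `k` uses up one
    -- unit.
    go : ∀ gap {k} → length p ℕ.≤ k ℕ.+ gap → d ℕ.≤ k → coeff p k ≈ 0#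
    go zero      {k} len≤ d≤k = DegreeBelow-length p (≡.subst (length p ℕ.≤_) (ℕ.+-identityʳ k) len≤)
    go (suc gap) {k} len≤ d≤k = K.trans (K.sym (K.+-identityˡ _))
      (K.trans (K.+-congʳ (K.sym (go gap (≡.subst (length p ℕ.≤_) (ℕ.+-suc k gap) len≤) (ℕ.m≤n⇒m≤1+n d≤k))))
        (K.trans (K.sym (coeff-1+t-suc p k)) (low (s≤s d≤k))))

  -- Removing a factor 1+t lowers the strict bound by one, and after all `n` factors the bound on
  -- `p` is 0.
  DegreeBelow-⋆⁻ : ∀ n p → DegreeBelow n (n ⋆ p) → p ≈ᵖ 0ᵖ
  DegreeBelow-⋆⁻ zero    p low = mk≈ λ k → low z≤n
  DegreeBelow-⋆⁻ (suc n) p low = DegreeBelow-⋆⁻ n p (DegreeBelow-1+t⁻ (n ⋆ p) low)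

  -- Sums of polynomials and cancellation of multiplicities

  Σᵖ-cong : ∀ {f g : A → Poly} → (∀ x → f x ≈ᵖ g x) → ∀ xs → Σᵖ (map f xs) ≈ᵖ Σᵖ (map g xs)
  Σᵖ-cong f≈g []       = P.refl
  Σᵖ-cong f≈g (x ∷ xs) = P.∙-cong (f≈g x) (Σᵖ-cong f≈g xs)

  Σᵖ-zero : ∀ {f : A → Poly} → (∀ x → f x ≈ᵖ 0ᵖ) → ∀ xs → Σᵖ (map f xs) ≈ᵖ 0ᵖ
  Σᵖ-zero f≈0 []       = P.refl
  Σᵖ-zero f≈0 (x ∷ xs) = P.∙-cong (f≈0 x) (Σᵖ-zero f≈0 xs)

  Σᵖ-+ : ∀ (f g : A → Poly) xs → Σᵖ (map f xs) +ᵖ Σᵖ (map g xs) ≈ᵖ Σᵖ (map (λ x → f x +ᵖ g x) xs)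
  Σᵖ-+ f g []       = P.refl
  Σᵖ-+ f g (x ∷ xs) = P.trans (P⁺.interchange (f x) _ (g x) _) (P.∙-congˡ {f x +ᵖ g x} (Σᵖ-+ f g xs))

  *ᵖ-Σᵖ : ∀ p (f : A → Poly) xs → p *ᵖ Σᵖ (map f xs) ≈ᵖ Σᵖ (map (λ x → p *ᵖ f x) xs)
  *ᵖ-Σᵖ p f []       = *ᵖ-zeroʳ p
  *ᵖ-Σᵖ p f (x ∷ xs) = P.trans (*ᵖ-distribˡ-+ᵖ p (f x) _) (P.∙-congˡ {p *ᵖ f x} (*ᵖ-Σᵖ p f xs))

  -- `m` counts the terms classified as equal to `T`; the other terms are invisible from degree `d`
  -- on.
  Σᵖ-multiple : ∀ d (f : A → Poly) T xs → (∀ {x} → x ∈ xs → f x ≈ᵖ T ⊎ DegreeBelow d (f x)) →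
    ∃[ m ] ∀ {k} → d ℕ.≤ k → coeff (Σᵖ (map f xs)) k ≈ m ∙ coeff T k
  Σᵖ-multiple d f T []       _  = 0 , λ _ → K.refl
  Σᵖ-multiple d f T (x ∷ xs) f∈ with Σᵖ-multiple d f T xs (f∈ ∘ there) | f∈ (here ≡.refl)
  ... | m , eq | inj₁ same = suc m , λ d≤k → K.trans (coeff-+ (f x) _ _) (K.+-cong (coeff≈ same _) (eq d≤k))
  ... | m , eq | inj₂ low  = m , λ d≤k → K.trans (coeff-+ (f x) _ _)
    (K.trans (K.+-cong (low d≤k) (eq d≤k)) (K.+-identityˡ _))

  -- The demand made on the scalars: it cancels the number of colourings that contribute the same
  -- leading term.
  TorsionFree : Set (c ⊔ ℓ)
  TorsionFree = ∀ m x → suc m ∙ x ≈ 0# → x ≈ 0#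

  PositiveIntegersInvertible : Set (c ⊔ ℓ)
  PositiveIntegersInvertible = ∀ m → ∃[ u ] u * (suc m ∙ 1#) ≈ 1#

  invertible⇒torsionFree : PositiveIntegersInvertible → TorsionFree
  invertible⇒torsionFree inverse m x mx≈0 with inverse m
  ... | u , um≈1 = begin
    x                      ≈⟨ K.*-identityˡ x ⟨
    1# * x                 ≈⟨ K.*-congʳ um≈1 ⟨
    u * (suc m ∙ 1#) * x   ≈⟨ K.*-assoc u _ x ⟩
    u * ((suc m ∙ 1#) * x) ≈⟨ K.*-congˡ (×-assoc-* (suc m) 1# x) ⟩
    u * (suc m ∙ (1# * x)) ≈⟨ K.*-congˡ (×-congʳ (suc m) (K.*-identityˡ x)) ⟩
    u * (suc m ∙ x)        ≈⟨ K.*-congˡ mx≈0 ⟩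
    u * 0#                 ≈⟨ K.zeroʳ u ⟩
    0#                     ∎
    where open ≈-Reasoning K.setoid

  -- Moving `x` to the front of the list makes the multiplicity of `T` a successor, hence positive,
  -- and torsion-freeness cancels it in every degree from `d` on.
  DegreeBelow-Σᵖ⁻ : TorsionFree → ∀ d (f : A → Poly) T {x xs} → (∀ {y} → y ∈ xs → f y ≈ᵖ T ⊎ DegreeBelow d (f y)) →
    x ∈ xs → f x ≈ᵖ T → DegreeBelow d (Σᵖ (map f xs)) → DegreeBelow d T
  DegreeBelow-Σᵖ⁻ torsionFree d f T {x} f∈ x∈xs fx≈T low {k} d≤k with ∈-∃++ x∈xs
  ... | ys , zs , ≡.refl with Perm.shift x ys zs
  ... | front with Σᵖ-multiple d f T (ys ++ zs) (f∈ ∘ Perm.∈-resp-↭ (↭-sym front) ∘ there)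
  ... | m , eq = torsionFree m (coeff T k) (K.trans
    (K.sym (K.trans (coeff-+ (f x) _ k) (K.+-cong (coeff≈ fx≈T k) (eq d≤k))))
    (K.trans (K.sym (coeff≈ (Σᵖ-↭ (Perm.map⁺ f front)) k)) (low d≤k)))

  -- The Tutte symmetric function of an extension

  -- B(L;π) with an arbitrary decidable relation in place of π, so that it covers both lying in one
  -- block and having one colour.
  blockSum : ∀ {n} → Combination n → {R : Fin n → Fin n → Set} → Decidable R → Poly
  blockSum L R? = Σᵖ (map (λ (p , H) → edgeCount R? H ⋆ p) L)

  blockSum-cong : ∀ {n} (L : Combination n) {R S : Fin n → Fin n → Set} (R? : Decidable R) (S? : Decidable S) →
    (∀ u v → R u v → S u v) → (∀ u v → S u v → R u v) → blockSum L R? ≈ᵖ blockSum L S?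
  blockSum-cong L R? S? R⊆S S⊆R = Σᵖ-cong
    (λ (p , H) → P.reflexive (≡.cong (_⋆ p) (edgeCount-cong R? S? R⊆S S⊆R H))) L

  B-blockSum : ∀ {n} (L : TutteStandardForm n) π → blockSum ⟦ L ⟧ (sameBlock? π) ≈ᵖ B L π
  B-blockSum {n} L π = go scalar exponent graph
    where
    open TutteStandardForm L
    -- The induction on the number of terms runs over the three families separately, since these
    -- restrict along `Fin.suc`.
    go : ∀ {k} (x : Fin k → Carrier) (e : Fin k → ℕ) (H : Fin k → Graph n) →
      blockSum (tabulate λ i → x i ·ᵖ 1+t ^ᵖ e i , H i) (sameBlock? π) ≈ᵖ
      Σᵖ (tabulate λ i → x i ·ᵖ 1+t ^ᵖ (e i ℕ.+ edgeCount (sameBlock? π) (H i)))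
    go {zero}  x e H = P.refl
    go {suc k} x e H = P.∙-cong (⋆-·ᵖ-^ᵖ (x Fin.zero) (e Fin.zero) _) (go (x ∘ Fin.suc) (e ∘ Fin.suc) (H ∘ Fin.suc))

  restricted? : ∀ {n N} (n≤N : n ℕ.≤ N) (κ : Colouring N) →
    Decidable (λ u v → lookup κ (inject≤ u n≤N) ≡ lookup κ (inject≤ v n≤N))
  restricted? n≤N κ u v = lookup κ (inject≤ u n≤N) ℕ.≟ lookup κ (inject≤ v n≤N)

  -- The sum over the terms of `L` is interchanged with the sum over colourings, and the factor due
  -- to the edges of `G` is common to all terms of `L`.
  XB-Ext : ∀ {n N} .{{_ : NonZero n}} (L : Combination n) (n≤N : n ℕ.≤ N) (G : Graph N) w →
    at (XB (Ext L n≤N G)) w ≈ᵖ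
    Σᵖ (map (λ κ → monochromaticEdges κ G ⋆ blockSum L (restricted? n≤N κ)) (colourings N w))
  XB-Ext {N = N} []            n≤N G w = P.sym (Σᵖ-zero (λ κ → ⋆-zeroʳ (monochromaticEdges κ G)) (colourings N w))
  XB-Ext {N = N} ((p , H) ∷ L) n≤N G w = P.trans
    (P.∙-cong (*ᵖ-Σᵖ p (weight (G ⊎ᵍ[ n≤N ] H)) (colourings N w)) (XB-Ext L n≤N G w))
    (P.trans (Σᵖ-+ _ _ (colourings N w)) (Σᵖ-cong term (colourings N w)))
    where
    term : ∀ κ → p *ᵖ weight (G ⊎ᵍ[ n≤N ] H) κ +ᵖ monochromaticEdges κ G ⋆ blockSum L (restricted? n≤N κ) ≈ᵖ
      monochromaticEdges κ G ⋆ blockSum ((p , H) ∷ L) (restricted? n≤N κ)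
    term κ = P.trans
      (P.∙-congʳ {monochromaticEdges κ G ⋆ blockSum L (restricted? n≤N κ)}
        (P.trans (*ᵖ-^ᵖ p (monochromaticEdges κ (G ⊎ᵍ[ n≤N ] H)))
          (P.reflexive (≡.trans (≡.cong (_⋆ p) (monochromaticEdges-⊎ κ G n≤N H)) (⋆-+ (monochromaticEdges κ G) _ p)))))
      (P.sym (⋆-distribˡ-+ᵖ (monochromaticEdges κ G) _ _))

  -- Vanishing block sums and modular relations

  blockSum-zero⇒modular : ∀ {n} .{{_ : NonZero n}} (L : Combination n) →
    (∀ π → blockSum L (sameBlock? π) ≈ᵖ 0ᵖ) → IsModularRelation L
  blockSum-zero⇒modular L zeros {N} n≤N G w = P.trans (XB-Ext L n≤N G w) (Σᵖ-zero term (colourings N w))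
    where
    term : ∀ κ → monochromaticEdges κ G ⋆ blockSum L (restricted? n≤N κ) ≈ᵖ 0ᵖ
    term κ = P.trans
      (⋆-cong (monochromaticEdges κ G) (P.trans
        -- The colour classes of `κ` restricted to [n] form the partition `fibres f`, to which the
        -- hypothesis applies.
        (blockSum-cong L (restricted? n≤N κ) (sameBlock? (fibres f))
          (λ _ _ → fibres-SameBlock⁺ f) (λ _ _ → fibres-SameBlock⁻ f))
        (zeros (fibres f))))
      (⋆-zeroʳ (monochromaticEdges κ G))
      where f = λ u → lookup κ (inject≤ u n≤N)

  -- All edges of `H` are counted, so the bound is uniform in the relation and one value serves
  -- every colouring.
  degreeBound : ∀ {n} → Combination n → ℕ
  degreeBound []            = 0
  degreeBound ((p , H) ∷ L) = (length (edges H) ℕ.+ length p) ℕ.⊔ degreeBound L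

  DegreeBelow-blockSum : ∀ {n} (L : Combination n) {R : Fin n → Fin n → Set} (R? : Decidable R) →
    DegreeBelow (degreeBound L) (blockSum L R?)
  DegreeBelow-blockSum []            R? _   = K.refl
  DegreeBelow-blockSum ((p , H) ∷ L) R? d≤k = DegreeBelow-+ {d = degreeBound ((p , H) ∷ L)}
    (edgeCount R? H ⋆ p) (blockSum L R?)
    (λ d≤k → DegreeBelow-⋆ (edgeCount R? H) p (DegreeBelow-length p)
      (ℕ.≤-trans (ℕ.+-monoˡ-≤ (length p) (List.length-filter _ (edges H))) (ℕ.m⊔n≤o⇒m≤o _ (degreeBound L) d≤k)))
    (λ d≤k → DegreeBelow-blockSum L R? (ℕ.m⊔n≤o⇒n≤o _ (degreeBound L) d≤k)) d≤k

  modular⇒blockSum-zero : TorsionFree → ∀ {n} .{{_ : NonZero n}} (L : Combination n) →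
    IsModularRelation L → ∀ π → blockSum L (sameBlock? π) ≈ᵖ 0ᵖ
  modular⇒blockSum-zero torsionFree {n} L modular π = DegreeBelow-⋆⁻ F (blockSum L (sameBlock? π))
    (DegreeBelow-Σᵖ⁻ torsionFree F term (F ⋆ blockSum L (sameBlock? π)) dichotomy (∈-colourings κ₀)
      (block-term κ₀ (blockColouring-SameBlock⁺ π) (blockColouring-SameBlock⁻ π) κ₀-full)
      -- Modularity is used with N = n: the coefficient at the content of `κ₀` is zero, hence of
      -- degree below `F`.
      (DegreeBelow-cong {d = F} (XB-Ext L ℕ.≤-refl G (toList κ₀)) λ _ → coeff≈ (modular ℕ.≤-refl G (toList κ₀)) _))
    where
    -- Missing one pair costs `M` factors 1+t, more than the degree of any `blockSum L` can make up.
    M = suc (degreeBound L)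
    κ₀ = blockColouring π
    pairs = blockPairs π
    -- The number of edges of `G`, reached as exponent exactly when every pair is monochromatic.
    F = M ℕ.* length pairs

    G : Graph n
    G = mkGraph (concat (replicate M pairs))

    term : Colouring n → Poly
    term κ = monochromaticEdges κ G ⋆ blockSum L (restricted? ℕ.≤-refl κ)

    inside : Colouring n → ℕ
    inside κ = monochromaticEdges κ (mkGraph pairs)

    edges-G : ∀ κ → monochromaticEdges κ G ≡ M ℕ.* inside κ
    edges-G κ = length-filter-copies _ M pairs

    κ₀-full : inside κ₀ ≡ length pairs
    κ₀-full = ≡.cong length (List.filter-all _
      (All.map (blockColouring-SameBlock⁺ π) (All.all-filter (uncurry (sameBlock? π)) (allPairs n))))

    block-term : ∀ κ → (∀ {u v} → SameBlock π u v → lookup κ u ≡ lookup κ v) →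
      (∀ {u v} → lookup κ u ≡ lookup κ v → SameBlock π u v) → inside κ ≡ length pairs →
      term κ ≈ᵖ F ⋆ blockSum L (sameBlock? π)
    block-term κ to from full = P.trans
      (P.reflexive (≡.cong (_⋆ blockSum L (restricted? ℕ.≤-refl κ)) (≡.trans (edges-G κ) (≡.cong (M ℕ.*_) full))))
      (⋆-cong F (blockSum-cong L (restricted? ℕ.≤-refl κ) (sameBlock? π)
        (λ u v eq → from (≡.trans (≡.sym (inj u)) (≡.trans eq (inj v))))
        (λ u v s → ≡.trans (inj u) (≡.trans (to s) (≡.sym (inj v))))))
      where
      inj : ∀ u → lookup κ (inject≤ u ℕ.≤-refl) ≡ lookup κ u
      inj u = ≡.cong (lookup κ) (Fin.inject≤-refl u ℕ.≤-refl)

    low-degree : ∀ κ → inside κ ℕ.< length pairs → DegreeBelow F (term κ)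
    low-degree κ lt F≤k = DegreeBelow-⋆ (monochromaticEdges κ G) _ (DegreeBelow-blockSum L (restricted? ℕ.≤-refl κ))
      (ℕ.≤-trans bound F≤k)
      where
      open ℕ.≤-Reasoning
      bound : monochromaticEdges κ G ℕ.+ degreeBound L ℕ.≤ F
      bound = begin
        monochromaticEdges κ G ℕ.+ degreeBound L ≡⟨ ≡.cong (ℕ._+ degreeBound L) (edges-G κ) ⟩
        M ℕ.* inside κ ℕ.+ degreeBound L         ≤⟨ ℕ.+-monoʳ-≤ (M ℕ.* inside κ) (ℕ.n≤1+n _) ⟩
        M ℕ.* inside κ ℕ.+ M                     ≡⟨ ℕ.+-comm (M ℕ.* inside κ) M ⟩
        M ℕ.+ M ℕ.* inside κ                     ≡⟨ ≡.sym (ℕ.*-suc M (inside κ)) ⟩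
        M ℕ.* suc (inside κ)                     ≤⟨ ℕ.*-monoʳ-≤ M lt ⟩
        F                                        ∎

    dichotomy : ∀ {κ} → κ ∈ colourings n (toList κ₀) →
      term κ ≈ᵖ F ⋆ blockSum L (sameBlock? π) ⊎ DegreeBelow F (term κ)
    dichotomy {κ} κ∈ with ℕ.m≤n⇒m<n∨m≡n (List.length-filter _ pairs)
    ... | inj₁ lt   = inj₂ (low-degree κ lt)
    ... | inj₂ full = inj₁ (block-term κ (proj₁ same) (proj₂ same) full)
      where
      same : ∀ {u v} → (SameBlock π u v → lookup κ u ≡ lookup κ v) × (lookup κ u ≡ lookup κ v → SameBlock π u v)
      -- Membership in `colourings` supplies the fact that `κ` has the same content as `κ₀`.
      same = blockPairs-monochromatic π κ (proj₂ (∈-filter⁻ _ {xs = colouringsIn (support (toList κ₀)) n} κ∈)) full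

  modular⇔B-zero : TorsionFree → ∀ {n} .{{_ : NonZero n}} (L : TutteStandardForm n) →
    IsModularRelation ⟦ L ⟧ ⇔ (∀ π → B L π ≈ᵖ 0ᵖ)
  modular⇔B-zero torsionFree L = mk⇔ necessary sufficient
    where
    necessary : IsModularRelation ⟦ L ⟧ → ∀ π → B L π ≈ᵖ 0ᵖ
    necessary modular π =
      P.trans (P.sym (B-blockSum L π)) (modular⇒blockSum-zero torsionFree ⟦ L ⟧ modular π)
    sufficient : (∀ π → B L π ≈ᵖ 0ᵖ) → IsModularRelation ⟦ L ⟧
    sufficient zeros = blockSum-zero⇒modular ⟦ L ⟧ λ π → P.trans (B-blockSum L π) (zeros π)

-- Positive integers are invertible in ℂ

private
  open TutteProperties ℂ-commutativeRing
    using (PositiveIntegersInvertible; invertible⇒torsionFree; modular⇔B-zero)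
  open ℝ using (seq)
  open Adjoin-i ℝ-commutativeRing using (R[i]; _+i_; _,_)
  open R[i]
  module ℂ = CommutativeRing ℂ-commutativeRing
  open SemiringMult ℂ.semiring using () renaming (_×_ to _∙ᶜ_)
  open SemiringMult (CommutativeRing.semiring ℚ.+-*-commutativeRing) using () renaming (_×_ to _∙_)

≗⇒≈ʳ : ∀ {x y} → (∀ n → seq x n ≡ seq y n) → x ≈ʳ y
≗⇒≈ʳ {x} {y} x≗y = record { null = λ ε 0<ε → 0 , λ n _ → ≡.subst (λ q → ℚ.∣ q ∣ ℚ.< ε)
  (≡.sym (≡.trans (≡.cong (ℚ._- seq y n) (x≗y n)) (ℚ.+-inverseʳ (seq y n)))) 0<ε }

-- A natural number in ℂ is given by constant rational sequences, which reduces its inversion to ℚ.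
re-∙1 : ∀ m n → seq (re (m ∙ᶜ ℂ.1#)) n ≡ m ∙ 1ℚ
re-∙1 zero    n = ≡.refl
re-∙1 (suc m) n = ≡.cong (1ℚ ℚ.+_) (re-∙1 m n)

im-∙1 : ∀ m n → seq (im (m ∙ᶜ ℂ.1#)) n ≡ 0ℚ
im-∙1 zero    n = ≡.refl
im-∙1 (suc m) n = ≡.cong (0ℚ ℚ.+_) (im-∙1 m n)

∙1-nonNegative : ∀ m → ℚ.NonNegative (m ∙ 1ℚ)
∙1-nonNegative zero    = _
∙1-nonNegative (suc m) = ℚ.nonNeg+nonNeg⇒nonNeg 1ℚ (m ∙ 1ℚ) {{∙1-nonNegative m}}

∙1-positive : ∀ m → ℚ.Positive (suc m ∙ 1ℚ)
∙1-positive m = ℚ.pos+nonNeg⇒pos 1ℚ (m ∙ 1ℚ) {{∙1-nonNegative m}}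

ℂ-inverse : PositiveIntegersInvertible
-- The inverse is that of the rational number m + 1, embedded as a constant real with imaginary part
-- 0.
ℂ-inverse m = constant (ℚ.1/ c) +i constant 0ℚ
  , ( ≗⇒≈ʳ (λ n → ≡.trans (≡.cong₂ (λ x y → ℚ.1/ c ℚ.* x ℚ.- 0ℚ ℚ.* y) (re-∙1 (suc m) n) (im-∙1 (suc m) n))
        -- The negated product of zeros computes to `0ℚ`.
        (≡.trans (ℚ.+-identityʳ _) (ℚ.*-inverseˡ c)))
    , ≗⇒≈ʳ (λ n → ≡.trans (≡.cong₂ (λ x y → ℚ.1/ c ℚ.* y ℚ.+ 0ℚ ℚ.* x) (re-∙1 (suc m) n) (im-∙1 (suc m) n))
        (≡.cong₂ ℚ._+_ (ℚ.*-zeroʳ (ℚ.1/ c)) (ℚ.*-zeroˡ c))) )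
  where
  c = suc m ∙ 1ℚ
  instance c≢0 = ℚ.pos⇒nonZero c {{∙1-positive m}}

open import Defs

theorem4 : (n : ℕ) .{{_ : NonZero n}} (L : TutteStandardForm n) →
    IsModularRelation ⟦ L ⟧ ⇔ (∀ (π : SetPartition n) → B L π ≈ᵖ 0ᵖ)
theorem4 n L = modular⇔B-zero (invertible⇒torsionFree ℂ-inverse) L
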